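{- Let $G=(V,E)$ be a graph, $v\in V$, $S_v$ the partial star product of $v$, let $\varphi_1,\dots,\varphi_k$ be the equivalence classes of $\mathfrak d_v^*$ that contain at least one edge of $E_v$, and let $H=\Box_{i=1}^k\mathbb S_i$ where $\mathbb S_i$ is the star factor of $\varphi_i$. Then: (1) $S_v$ is isomorphic to the induced subgraph $\langle N_2^H[\bar v]\rangle$, where $\bar v=(v,\dots,v)$ is the vertex of $H$ all of whose coordinates are the star-centers; in particular $S_v$ is an isometric subgraph of $H$. More precisely, there is an isomorphism $\gamma$ from $S_v$ onto $\langle N_2^H[\bar v]\rangle$ with $\gamma(v)=\bar v$ and $\gamma(u)$ equal to the vertex with $i$-th coordinate $u$ and all other coordinates $v$ for every $u\in N_{\varphi_i}(v)$, and $\gamma$ is an isometric embedding of $S_v$ into $H$. (2) Identifying $S_v$ with its image under $\gamma$, one has $\mathfrak d_{|S_v}\subseteq\delta(H)^*\subseteq\sigma(H)$. (3) The product relation $\sigma(H)$ has the same number of equivalence classes as $\mathfrak d_{|S_v}$.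
   Context: All graphs are finite, simple and undirected. For $G=(V,E)$ and $v\in V$, $E_v$ is the set of edges incident to $v$. For two distinct adjacent edges $e=(v,u)$, $f=(v,w)$, a square spanned by $e$ and $f$ is a $4$-cycle $v,u,x,w,v$ with $x\notin\{v,u,w\}$ ($x$ its top vertex); it is chordless if neither $(u,w)$ nor $(v,x)$ is an edge. In a chordless square $v,u,x,w$, $(x,w)$ is opposite to $(v,u)$ and $(x,u)$ is opposite to $(v,w)$ (and vice versa). For any graph $X$, the relation $\delta(X)$ on $E(X)$: $(e,f)\in\delta(X)$ iff (i) $e,f$ are distinct adjacent edges and it is not the case that $e$ and $f$ span exactly one square and that square is chordless; or (ii) $e,f$ are opposite edges of a chordless square; or (iii) $e=f$. $R^*$ denotes the transitive closure of a relation $R$. Define $\mathfrak d_v=((E_v\times E)\cup(E\times E_v))\cap\delta(G)$ and $\mathfrak d_v^*$ the finest equivalence relation on $E$ containing $\mathfrak d_v$. Let $F_v\subseteq E\setminus E_v$ be the set of edges that are the edges not incident to $v$ of some chordless square spanned by two edges $e,e'\in E_v$ with $(e,e')\notin\mathfrak d_v^*$. The partial star product $S_v$ is the subgraph of $G$ with edge set $E_v\cup F_v$ and vertex set the endpoints of these edges. $\mathfrak d_{|S_v}=\{(e,f)\in\mathfrak d_v^*: e,f\in E(S_v)\}$. For an equivalence class $\varphi$ of $\mathfrak d_v^*$, $N_\varphi(v)=\{u:(v,u)\in\varphi\}$ and $N_\varphi[v]=N_\varphi(v)\cup\{v\}$; the star factor of $\varphi$ is the graph with vertex set $N_\varphi[v]$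 and edge set $\{(v,u):u\in N_\varphi(v)\}$ (a star with center $v$). Cartesian product $\Box$: vertex set is the Cartesian product of vertex sets, two vertices adjacent iff they differ in exactly one coordinate and those coordinates are adjacent in the corresponding factor. $N_2^H[x]=\{y: d_H(x,y)\le2\}$. An isometric embedding is an injective map preserving distances. Every connected graph has a unique decomposition into Cartesian prime factors (up to order and isomorphism); the product relation $\sigma(H)$ on $E(H)$ relates two edges iff their endpoints differ in the coordinate of the same prime factor with respect to the prime factor decomposition of $H$. -}

module Defs where

open import Data.Fin.Base using (Fin; zero; suc)
open import Data.Nat.Base using (ℕ; suc; _≤_)
open import Data.Product.Base using (Σ; Σ-syntax; ∃-syntax; _×_; _,_; proj₁; proj₂)
open import Data.Sum.Base using (_⊎_; inj₁; inj₂; swap)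
open import Function.Bundles using (Inverse; _⇔_)
open import Level using (0ℓ) renaming (suc to lsuc; _⊔_ to _⊔ˡ_)
open import Relation.Binary.Bundles using (Setoid)
open import Relation.Binary.Construct.Closure.Equivalence using (EqClosure)
open import Relation.Binary.Construct.Union using (_∪_)
open import Relation.Binary.Core using (Rel)
open import Relation.Binary.Definitions using (Decidable; Symmetric; _Respects₂_)
open import Relation.Binary.PropositionalEquality.Core as ≡ using (_≡_; _≢_)
import Relation.Binary.PropositionalEquality.Properties as ≡ using (isEquivalence; setoid)
open import Relation.Binary.Structures using (IsEquivalence)
open import Relation.Nullary.Negation.Core using (¬_)
open import Relation.Unary using (Pred; _≐_)

-- Simple undirected graphs.  Vertices form a setoid because subgraphs have
-- vertex type Σ V P (compared by first component) and products have
-- vertex type ∀ i → V i (compared pointwise).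
record Graph : Set₁ where
  infix 4 _≈_ _~_
  field
    Vertex        : Set
    _≈_           : Rel Vertex 0ℓ
    isEquivalence : IsEquivalence _≈_
    _~_           : Rel Vertex 0ℓ
    ~-resp        : _~_ Respects₂ _≈_
    ~-sym         : Symmetric _~_
    ~-irrefl      : ∀ {x y} → x ≈ y → ¬ x ~ y

  open IsEquivalence isEquivalence public
    using () renaming (refl to ≈-refl; sym to ≈-sym; trans to ≈-trans)

  vertices : Setoid 0ℓ 0ℓ
  vertices = record { isEquivalence = isEquivalence }

-- A finite graph.  The graphs derived from one below (S_v, the star factors,
-- their product and its prime factors) are then finite as well, so
-- finiteness is only recorded for the given graph.
record FinGraph : Set₁ where
  infix 4 _~_
  field
    order    : ℕ
    _~_      : Rel (Fin order) 0ℓ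
    ~-dec    : Decidable _~_
    ~-sym    : Symmetric _~_
    ~-irrefl : ∀ {x} → ¬ x ~ x

  graph : Graph
  graph = record
    { Vertex        = Fin order
    ; _≈_           = _≡_
    ; isEquivalence = ≡.isEquivalence
    ; _~_           = _~_
    ; ~-resp        = (λ { ≡.refl p → p }) , (λ { ≡.refl p → p })
    ; ~-sym         = ~-sym
    ; ~-irrefl      = λ { ≡.refl → ~-irrefl }
    }

module _ (X : Graph) where
  open Graph X

  -- An edge {src , tgt}, written with one of its two orientations; _≈ᴱ_
  -- identifies the two, and every relation on edges below is invariant
  -- under _≈ᴱ_.
  record Edge : Set where
    constructor edge
    field
      src tgt  : Vertex
      adjacent : src ~ tgt

  Joins : Edge → Vertex → Vertex → Set
  Joins e x y = (src ≈ x × tgt ≈ y) ⊎ (src ≈ y × tgt ≈ x)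
    where open Edge e

  _≈ᴱ_ : Rel Edge 0ℓ
  e ≈ᴱ f = Joins e (Edge.src f) (Edge.tgt f)

  Incident : Vertex → Pred Edge 0ℓ
  Incident v e = Edge.src e ≈ v ⊎ Edge.tgt e ≈ v

  -- x is the top vertex of a square v,u,x,w,v; the definition is meant for
  -- distinct neighbours u, w of v, which Square includes so that it describes
  -- a 4-cycle on its own.
  record Square (v u x w : Vertex) : Set where
    field
      v~u : v ~ u
      u~x : u ~ x
      x~w : x ~ w
      w~v : w ~ v
      u≉w : ¬ u ≈ w
      x≉v : ¬ x ≈ v
      x≉u : ¬ x ≈ u
      x≉w : ¬ x ≈ w

  ChordlessSquare : (v u x w : Vertex) → Set
  ChordlessSquare v u x w = Square v u x w × ¬ u ~ w × ¬ v ~ x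

  -- The edges vu and vw span exactly one square, and that square is chordless.
  SpanUniqueChordless : (v u w : Vertex) → Set
  SpanUniqueChordless v u w =
    ∃[ x ] ChordlessSquare v u x w × (∀ y → Square v u y w → y ≈ x)

  data δ (e f : Edge) : Set where
    adjacent : ∀ v u w → Joins e v u → Joins f v w → ¬ u ≈ w →
               ¬ SpanUniqueChordless v u w → δ e f
    -- Relabelling the square cyclically yields the other pairs of opposite edges.
    opposite : ∀ v u x w → ChordlessSquare v u x w →
               Joins e v u → Joins f x w → δ e f
    equal    : e ≈ᴱ f → δ e f

  data Walk : ℕ → Vertex → Vertex → Set where
    stop : ∀ {x y} → x ≈ y → Walk 0 x y
    step : ∀ {n x y z} → x ~ y → Walk n y z → Walk (suc n) x z

  -- d(x , y) = n
  Distance : Vertex → Vertex → ℕ → Set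
  Distance x y n = Walk n x y × (∀ m → Walk m x y → n ≤ m)

  N₂[_] : Vertex → Pred Vertex 0ℓ
  N₂[ x ] y = ∃[ n ] Distance x y n × n ≤ 2

  ⟨_⟩ : Pred Vertex 0ℓ → Graph
  ⟨ P ⟩ = record
    { Vertex        = Σ Vertex P
    ; _≈_           = λ x y → proj₁ x ≈ proj₁ y
    ; isEquivalence = record { refl = ≈-refl ; sym = ≈-sym ; trans = ≈-trans }
    ; _~_           = λ x y → proj₁ x ~ proj₁ y
    ; ~-resp        = proj₁ ~-resp , proj₂ ~-resp
    ; ~-sym         = ~-sym
    ; ~-irrefl      = ~-irrefl
    }

  Nontrivial : Set
  Nontrivial = ∃[ x ] ∃[ y ] ¬ x ≈ y

module _ (X Y : Graph) where
  private
    module X = Graph X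
    module Y = Graph Y

  infix 4 _≅_
  record _≅_ : Set where
    field
      bijection : Inverse X.vertices Y.vertices
    open Inverse bijection public using (to; from; to-cong; from-cong)
    field
      ~-preserving : ∀ {x y} → x X.~ y → to x Y.~ to y
      ~-reflecting : ∀ {x y} → to x Y.~ to y → x X.~ y

  record IsIsometricEmbedding (f : X.Vertex → Y.Vertex) : Set where
    field
      cong      : ∀ {x y} → x X.≈ y → f x Y.≈ f y
      injective : ∀ {x y} → f x Y.≈ f y → x X.≈ y
      distance  : ∀ x y n → Distance X x y n ⇔ Distance Y (f x) (f y) n

-- Cartesian product of finitely many graphs; the empty product is K₁.
□ : ∀ {k} → (Fin k → Graph) → Graph
□ {k} F = record
  { Vertex        = ∀ i → F.Vertex i
  ; _≈_           = λ x y → ∀ i → F._≈_ i (x i) (y i)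
  ; isEquivalence = record
    { refl  = λ i → F.≈-refl i
    ; sym   = λ p i → F.≈-sym i (p i)
    ; trans = λ p q i → F.≈-trans i (p i) (q i)
    }
  ; _~_           = λ x y → ∃[ i ] F._~_ i (x i) (y i) ×
                              (∀ j → j ≢ i → F._≈_ j (x j) (y j))
  ; ~-resp        =
      (λ p (i , a , q) → i , proj₁ (F.~-resp i) (p i) a ,
                         λ j j≢i → F.≈-trans j (q j j≢i) (p j)) ,
      (λ p (i , a , q) → i , proj₂ (F.~-resp i) (p i) a ,
                         λ j j≢i → F.≈-trans j (F.≈-sym j (p j)) (q j j≢i))
  ; ~-sym         = λ (i , a , q) → i , F.~-sym i a ,
                                    λ j j≢i → F.≈-sym j (q j j≢i)
  ; ~-irrefl      = λ p (i , a , _) → F.~-irrefl i (p i) a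
  }
  where module F (i : Fin k) = Graph (F i)

Prime : Graph → Set₁
Prime X = Nontrivial X ×
  (∀ (F : Fin 2 → Graph) → X ≅ □ F →
     ¬ (Nontrivial (F zero) × Nontrivial (F (suc zero))))

record PrimeFactorization (H : Graph) : Set₁ where
  field
    size   : ℕ
    factor : Fin size → Graph
    prime  : ∀ i → Prime (factor i)
    iso    : H ≅ □ factor

  coordinate : Graph.Vertex H → ∀ i → Graph.Vertex (factor i)
  coordinate = _≅_.to iso

  DifferAt : Fin size → Pred (Edge H) 0ℓ
  DifferAt i e = ¬ coordinate (Edge.src e) i ≈ coordinate (Edge.tgt e) i
    where open Graph (factor i)

-- The product relation, for connected H.  By uniqueness of the prime
-- factorization it does not matter which one is used as witness.
σ : (H : Graph) → Rel (Edge H) (lsuc 0ℓ)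
σ H e f = Σ[ D ∈ PrimeFactorization H ] (let open PrimeFactorization D in
  ∃[ i ] DifferAt i e × DifferAt i f)

-- R is an equivalence relation with exactly n classes.
NumberOfClasses : ∀ {a ℓ} {A : Set a} → Rel A ℓ → ℕ → Set (a ⊔ˡ ℓ)
NumberOfClasses {A = A} R n = Σ[ eq ∈ IsEquivalence R ]
  Inverse (≡.setoid (Fin n)) (record { Carrier = A ; _≈_ = R ; isEquivalence = eq })

module _ (G : Graph) (v : Graph.Vertex G) where
  open Graph G

  𝔡 : Rel (Edge G) 0ℓ
  𝔡 e f = (Incident G v e ⊎ Incident G v f) × δ G e f

  -- The finest equivalence relation on E containing 𝔡; _≈ᴱ_ is the equality
  -- of E and has to be included since edges carry an orientation.
  𝔡* : Rel (Edge G) 0ℓ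
  𝔡* = EqClosure (_≈ᴱ_ G ∪ 𝔡)

  F : Pred (Edge G) 0ℓ
  F g = ∃[ e ] ∃[ e′ ] ∃[ u ] ∃[ x ] ∃[ w ]
    Joins G e v u × Joins G e′ v w × ¬ 𝔡* e e′ ×
    ChordlessSquare G v u x w × (Joins G g u x ⊎ Joins G g w x)

  StarProductEdge : Pred (Edge G) 0ℓ
  StarProductEdge e = Incident G v e ⊎ F e

  -- The endpoints of the edges; v itself is listed separately only to have
  -- S = K₁ (rather than the empty graph) when v is isolated.
  StarProductVertex : Pred Vertex 0ℓ
  StarProductVertex x = x ≈ v ⊎ (∃[ e ] StarProductEdge e × Incident G x e)

  S : Graph
  S = record
    { Vertex        = Σ Vertex StarProductVertex
    ; _≈_           = λ x y → proj₁ x ≈ proj₁ y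
    ; isEquivalence = record { refl = ≈-refl ; sym = ≈-sym ; trans = ≈-trans }
    ; _~_           = λ x y → ∃[ e ] StarProductEdge e × Joins G e (proj₁ x) (proj₁ y)
    ; ~-resp        = (λ p (e , s , j) → e , s , joinsʳ e p j) ,
                      (λ p (e , s , j) → e , s , swap (joinsʳ e p (swap j)))
    ; ~-sym         = λ (e , s , j) → e , s , swap j
    ; ~-irrefl      = λ p (e , _ , j) → ~-irrefl p (joins⇒~ e j)
    }
    module S where
      joinsʳ : ∀ e {x y z} → y ≈ z → Joins G e x y → Joins G e x z
      joinsʳ e p (inj₁ (a , b)) = inj₁ (a , ≈-trans b p)
      joinsʳ e p (inj₂ (a , b)) = inj₂ (≈-trans a p , b)

      joins⇒~ : ∀ e {x y} → Joins G e x y → x ~ y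
      joins⇒~ (edge _ _ a) (inj₁ (p , q)) = proj₁ ~-resp q (proj₂ ~-resp p a)
      joins⇒~ (edge _ _ a) (inj₂ (p , q)) = ~-sym (proj₁ ~-resp q (proj₂ ~-resp p a))

  inclusion : Edge S → Edge G
  inclusion (edge x y (e , _ , j)) = edge (proj₁ x) (proj₁ y) (S.joins⇒~ e j)

  𝔡∣S : Rel (Edge S) 0ℓ
  𝔡∣S e f = 𝔡* (inclusion e) (inclusion f)

  N : Pred (Edge G) 0ℓ → Pred Vertex 0ℓ
  N φ u = ∃[ e ] φ e × Joins G e v u

  StarFactor : Pred (Edge G) 0ℓ → Graph
  StarFactor φ = record
    { Vertex        = Σ Vertex (λ u → u ≈ v ⊎ N φ u)
    ; _≈_           = λ x y → proj₁ x ≈ proj₁ y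
    ; isEquivalence = record { refl = ≈-refl ; sym = ≈-sym ; trans = ≈-trans }
    ; _~_           = λ x y → (proj₁ x ≈ v × N φ (proj₁ y)) ⊎ (proj₁ y ≈ v × N φ (proj₁ x))
    ; ~-resp        = (λ { p (inj₁ (c , n)) → inj₁ (c , N-resp p n)
                         ; p (inj₂ (c , n)) → inj₂ (≈-trans (≈-sym p) c , n) }) ,
                      (λ { p (inj₁ (c , n)) → inj₁ (≈-trans (≈-sym p) c , n)
                         ; p (inj₂ (c , n)) → inj₂ (c , N-resp p n) })
    ; ~-sym         = swap
    ; ~-irrefl      = λ { p (inj₁ (c , n)) → N-irrefl (≈-trans (≈-sym c) p) n
                        ; p (inj₂ (c , n)) → N-irrefl (≈-trans (≈-sym c) (≈-sym p)) n }
    }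
    where
      N-resp : ∀ {x y} → x ≈ y → N φ x → N φ y
      N-resp p (e , e∈φ , j) = e , e∈φ , S.joinsʳ e p j

      N-irrefl : ∀ {x} → v ≈ x → ¬ N φ x
      N-irrefl p (e , _ , j) = ~-irrefl p (S.joins⇒~ e j)

  IsClass : Pred (Edge G) 0ℓ → Set
  IsClass φ = ∃[ e ] (∀ f → φ f ⇔ 𝔡* e f)

  -- φ lists, without repetition, the classes of 𝔡* containing an edge at v.
  record Enumerates {k} (φ : Fin k → Pred (Edge G) 0ℓ) : Set where
    field
      isClass  : ∀ i → IsClass (φ i)
      meets    : ∀ i → ∃[ e ] Incident G v e × φ i e
      distinct : ∀ i j → φ i ≐ φ j → i ≡ j
      complete : ∀ e → Incident G v e → ∃[ i ] φ i e

  module _ {k} (φ : Fin k → Pred (Edge G) 0ℓ) where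

    StarProduct : Graph
    StarProduct = □ (λ i → StarFactor (φ i))

    centre : Graph.Vertex StarProduct
    centre _ = v , inj₁ ≈-refl

  centreˢ : Graph.Vertex S
  centreˢ = v , inj₁ ≈-refl

  neighbourˢ : ∀ {φ u} → N φ u → Graph.Vertex S
  neighbourˢ {u = u} (e , _ , j) = u , inj₂ (e , inj₁ (left j) , right j)
    where
      left : Joins G e v u → Incident G v e
      left (inj₁ (p , _)) = inj₁ p
      left (inj₂ (_ , q)) = inj₂ q
      right : Joins G e v u → Incident G u e
      right (inj₁ (_ , q)) = inj₂ q
      right (inj₂ (p , _)) = inj₁ p

mapEdge : ∀ {X Y P} → X ≅ ⟨_⟩ Y P → Edge X → Edge Y
mapEdge γ (edge x y a) = edge (proj₁ (to x)) (proj₁ (to y)) (~-preserving a)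
  where open _≅_ γ

{-# OPTIONS --safe #-}
module Submission where

open import Defs
open import Data.Empty using (⊥-elim)
open import Data.Fin.Base using (Fin; zero; suc)
open import Data.Fin.Properties using (_≟_; ∀-cons; all?; any?; ¬∀⟶∃¬)
open import Data.Nat.Base using (ℕ; zero; suc; _+_; _≤_; _<_; z≤n; s≤s)
open import Data.Nat.Properties using (≤-refl; ≤-trans; ≤-antisym; ≤-pred; n<1+n)
open import Data.Product.Base using (Σ-syntax; ∃-syntax; _×_; _,_; proj₁; proj₂)
open import Data.Sum.Base using (_⊎_; inj₁; inj₂; [_,_]′; swap)
open import Function.Base using (_∘_)
open import Function.Bundles using (Inverse; Equivalence; mk⇔)
open import Level using (0ℓ)
import Relation.Binary.Construct.Closure.Equivalence as EqC
open import Relation.Binary.Construct.Closure.Transitive using (TransClosure; [_]; _∷_; _++_)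
import Relation.Binary.Construct.On as On
open import Relation.Binary.Core using (Rel)
open import Relation.Binary.Definitions using (Decidable; Transitive)
open import Relation.Binary.PropositionalEquality using (_≡_; _≢_; refl; sym; trans; cong; subst)
open import Relation.Binary.Structures using (IsEquivalence)
open import Relation.Nullary using (¬_; Dec; yes; no)
open import Relation.Nullary.Decidable using (map′; _×-dec_; _→-dec_; ¬?)
open import Relation.Unary using (Pred)

-- Let vu and vw lie in different classes, and let x be the top of the unique
-- square they span.  Then u and w are the only common neighbours of v and x:
-- a third one would make uv and ux span two squares, hence related, while ux
-- is opposite to vw.  So sending x to the vertex of H with coordinates u and
-- w identifies S_v with the ball of radius 2 about the centre.  It is
-- isometric since a walk leaving a leaf coordinate can be shortened by moving
-- that coordinate to the star centre first.  In a product, δ preserves the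
-- direction of edges, and in a product of stars edges of one direction are
-- δ*-related because adjacent ones span no square.  Hence any prime
-- factorization groups the star directions, and primality leaves one per
-- group, so the classes of σ(H), δ(H)* and 𝔡 are all given by the directions.

-- Updating one coordinate of a dependent function

module _ {k} {A : Fin k → Set} where

  infixl 6 _[_≔_]
  _[_≔_] : (∀ i → A i) → ∀ i → A i → ∀ i → A i
  (f [ i ≔ a ]) j with i ≟ j
  ... | yes refl = a
  ... | no  _    = f j

  ≔-same : ∀ (f : ∀ i → A i) i {a} → (f [ i ≔ a ]) i ≡ a
  ≔-same f i with i ≟ i
  ... | yes refl = refl
  ... | no  i≢i  = ⊥-elim (i≢i refl)

  ≔-other : ∀ (f : ∀ i → A i) {i j a} → j ≢ i → (f [ i ≔ a ]) j ≡ f j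
  ≔-other f {i} {j} j≢i with i ≟ j
  ... | yes refl = ⊥-elim (j≢i refl)
  ... | no  _    = refl

-- Walks, edges and squares in a single graph

module _ (X : Graph) where
  open Graph X

  Connected : Set
  Connected = ∀ x y → ∃[ n ] Walk X n x y

  walk-respˡ : ∀ {n x y z} → x ≈ y → Walk X n x z → Walk X n y z
  walk-respˡ p (stop q)   = stop (≈-trans (≈-sym p) q)
  walk-respˡ p (step a w) = step (proj₂ ~-resp p a) w

  walk-++ : ∀ {m n x y z} → Walk X m x y → Walk X n y z → Walk X (m + n) x z
  walk-++ (stop p)   w′ = walk-respˡ (≈-sym p) w′
  walk-++ (step a w) w′ = step a (walk-++ w w′)

  walk-snoc : ∀ {n x y z} → Walk X n x y → y ~ z → Walk X (suc n) x z
  walk-snoc (stop p)   a = step (proj₂ ~-resp (≈-sym p) a) (stop ≈-refl)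
  walk-snoc (step b w) a = step b (walk-snoc w a)

  walk-reverse : ∀ {n x y} → Walk X n x y → Walk X n y x
  walk-reverse (stop p)   = stop (≈-sym p)
  walk-reverse (step a w) = walk-snoc (walk-reverse w) (~-sym a)

  walk-fold : ∀ {ℓ} (R : Rel Vertex ℓ) → Transitive R → (∀ {x y} → x ≈ y → R x y) →
              (∀ {x y} → x ~ y → R x y) → ∀ {n x y} → Walk X n x y → R x y
  walk-fold R R-trans ≈⇒R ~⇒R (stop p)   = ≈⇒R p
  walk-fold R R-trans ≈⇒R ~⇒R (step a w) =
    R-trans (~⇒R a) (walk-fold R R-trans ≈⇒R ~⇒R w)

  joins-self : ∀ e → Joins X e (Edge.src e) (Edge.tgt e)
  joins-self e = inj₁ (≈-refl , ≈-refl)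

  ≈ᴱ-sym : ∀ e f → _≈ᴱ_ X e f → _≈ᴱ_ X f e
  ≈ᴱ-sym e f (inj₁ (a , b)) = inj₁ (≈-sym a , ≈-sym b)
  ≈ᴱ-sym e f (inj₂ (a , b)) = inj₂ (≈-sym b , ≈-sym a)

  square-resp : ∀ {v u x y w} → x ≈ y → Square X v u x w → Square X v u y w
  square-resp p sq = record
    { v~u = v~u ; u~x = proj₁ ~-resp p u~x ; x~w = proj₂ ~-resp p x~w ; w~v = w~v
    ; u≉w = u≉w ; x≉v = x≉v ∘ ≈-trans p ; x≉u = x≉u ∘ ≈-trans p ; x≉w = x≉w ∘ ≈-trans p }
    where open Square sq

-- Products

module _ {k} (F : Fin k → Graph) where
  private
    module F i = Graph (F i)
    module P = Graph (□ F)

  StepsAt : Fin k → Rel P.Vertex 0ℓ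
  StepsAt i x y = F._~_ i (x i) (y i) × (∀ j → j ≢ i → F._≈_ j (x j) (y j))

  dir : Edge (□ F) → Fin k
  dir e = proj₁ (Edge.adjacent e)

  stepsAt-sym : ∀ {i x y} → StepsAt i x y → StepsAt i y x
  stepsAt-sym {i} s = proj₂ (P.~-sym (i , s))

  stepsAt-≉ : ∀ {i x y} → StepsAt i x y → ¬ F._≈_ i (x i) (y i)
  stepsAt-≉ {i} (a , _) p = F.~-irrefl i p a

  stepsAt-from-≉ : ∀ {i j x y} → StepsAt i x y → ¬ F._≈_ j (x j) (y j) → j ≡ i
  stepsAt-from-≉ {i} {j} (_ , q) n with j ≟ i
  ... | yes p   = p
  ... | no  j≢i = ⊥-elim (n (q j j≢i))

  stepsAt-unique : ∀ {i j x y} → StepsAt i x y → StepsAt j x y → i ≡ j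
  stepsAt-unique s t = stepsAt-from-≉ t (stepsAt-≉ s)

  joins⇒stepsAt : ∀ e {x y} → Joins (□ F) e x y → StepsAt (dir e) x y
  joins⇒stepsAt (edge x y (i , s)) (inj₁ (p , q)) =
    proj₂ (proj₁ P.~-resp q (proj₂ P.~-resp p (i , s)))
  joins⇒stepsAt (edge x y (i , s)) (inj₂ (p , q)) =
    stepsAt-sym (proj₂ (proj₁ P.~-resp q (proj₂ P.~-resp p (i , s))))

  -- Around a closed walk every change of a coordinate must be undone. Suppose that `s` and `t`
  -- differ. If `s ≡ s′`, only the last step can restore coordinate `t`, so `x` and `v` agree;
  -- otherwise only the last step can restore coordinate `s`, so `u` and `w` agree.
  square-opposite : ∀ {v u x w s s′ t t′} →
    StepsAt s v u → StepsAt s′ u x → StepsAt t x w → StepsAt t′ w v →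
    ¬ u P.≈ w → ¬ x P.≈ v → s ≡ t
  square-opposite {v} {u} {x} {w} {s} {s′} {t} {t′} vu ux xw wv u≉w x≉v with s ≟ t
  ... | yes p = p
  ... | no s≢t with s ≟ s′
  ...   | yes refl = ⊥-elim (x≉v x≈v)
    where
    x≈v-at-t : F._≈_ t (x t) (v t)
    x≈v-at-t = F.≈-sym t (F.≈-trans t (proj₂ vu t (s≢t ∘ sym)) (proj₂ ux t (s≢t ∘ sym)))
    t≡t′ : t ≡ t′
    t≡t′ = stepsAt-from-≉ wv λ p →
      stepsAt-≉ xw (F.≈-trans t x≈v-at-t (F.≈-sym t p))
    x≈v : x P.≈ v
    x≈v j with j ≟ t
    ... | yes refl = x≈v-at-t
    ... | no  j≢t  = F.≈-trans j (proj₂ xw j j≢t) (proj₂ wv j (λ p → j≢t (trans p (sym t≡t′))))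
  ...   | no s≢s′ = ⊥-elim (u≉w u≈w)
    where
    u≈w-at-s : F._≈_ s (u s) (w s)
    u≈w-at-s = F.≈-trans s (proj₂ ux s s≢s′) (proj₂ xw s s≢t)
    s≡t′ : s ≡ t′
    s≡t′ = stepsAt-from-≉ wv λ p →
      stepsAt-≉ vu (F.≈-sym s (F.≈-trans s u≈w-at-s p))
    u≈w : u P.≈ w
    u≈w j with j ≟ s
    ... | yes refl = u≈w-at-s
    ... | no  j≢s  = F.≈-trans j (F.≈-sym j (proj₂ vu j j≢s))
                       (F.≈-sym j (proj₂ wv j (λ p → j≢s (trans p (sym s≡t′)))))

  -- The top takes coordinate `s` from `u` and coordinate `t` from `w`. As `u` and `w` differ at
  -- exactly these two coordinates, a common neighbour has to change them one at a time, and the two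
  -- possible orders give the top and `v` itself.
  distinct-directions⇒square : ∀ {v u w s t} → s ≢ t → StepsAt s v u → StepsAt t v w →
                               SpanUniqueChordless (□ F) v u w
  distinct-directions⇒square {v} {u} {w} {s} {t} s≢t vu vw =
    x , (square , u≁w , v≁x) , unique
    where
    x : P.Vertex
    x = u [ t ≔ w t ]
    xt : F._≈_ t (x t) (w t)
    xt = IsEquivalence.reflexive (F.isEquivalence t) (≔-same u t)
    xj : ∀ j → j ≢ t → F._≈_ j (x j) (u j)
    xj j j≢t = IsEquivalence.reflexive (F.isEquivalence j) (≔-other u j≢t)
    us≉ws : ¬ F._≈_ s (u s) (w s)
    us≉ws p = stepsAt-≉ vu (F.≈-trans s (proj₂ vw s s≢t) (F.≈-sym s p))
    ut≉wt : ¬ F._≈_ t (u t) (w t)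
    ut≉wt p = stepsAt-≉ vw (F.≈-trans t (proj₂ vu t (s≢t ∘ sym)) p)
    ux : StepsAt t u x
    ux = proj₁ (F.~-resp t) (F.≈-sym t xt)
           (proj₂ (F.~-resp t) (proj₂ vu t (s≢t ∘ sym)) (proj₁ vw))
       , λ j j≢t → F.≈-sym j (xj j j≢t)
    xw-off : ∀ j → j ≢ s → F._≈_ j (x j) (w j)
    xw-off j j≢s with j ≟ t
    ... | yes refl = xt
    ... | no  j≢t  = F.≈-trans j (xj j j≢t)
                       (F.≈-trans j (F.≈-sym j (proj₂ vu j j≢s)) (proj₂ vw j j≢t))
    xw : StepsAt s x w
    xw = proj₂ (F.~-resp s) (F.≈-sym s (xj s s≢t))
           (proj₁ (F.~-resp s) (proj₂ vw s s≢t) (F.~-sym s (proj₁ vu)))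
       , xw-off
    square : Square (□ F) v u x w
    square = record
      { v~u = s , vu ; u~x = t , ux ; x~w = s , xw ; w~v = t , stepsAt-sym vw
      ; u≉w = λ p → us≉ws (p s)
      ; x≉v = λ p → stepsAt-≉ vu (F.≈-sym s (F.≈-trans s (F.≈-sym s (xj s s≢t)) (p s)))
      ; x≉u = λ p → stepsAt-≉ ux (F.≈-sym t (p t))
      ; x≉w = λ p → stepsAt-≉ xw (p s) }
    u≁w : ¬ u P.~ w
    u≁w (r , uw) = s≢t (trans (stepsAt-from-≉ uw us≉ws) (sym (stepsAt-from-≉ uw ut≉wt)))
    v≁x : ¬ v P.~ x
    v≁x (r , vx) = s≢t (trans
      (stepsAt-from-≉ vx λ p → stepsAt-≉ vu (F.≈-trans s p (xj s s≢t)))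
      (sym (stepsAt-from-≉ vx λ p → stepsAt-≉ vw (F.≈-trans t p xt))))
    unique : ∀ y → Square (□ F) v u y w → y P.≈ x
    unique y sq with Square.u~x sq | Square.x~w sq
    ... | r , uy | r′ , yw with t ≟ r
    ...   | yes refl = y≈x
      where
      s≡r′ : s ≡ r′
      s≡r′ = stepsAt-from-≉ yw λ p → us≉ws (F.≈-trans s (proj₂ uy s s≢t) p)
      y≈x : y P.≈ x
      y≈x j with j ≟ t
      ... | yes refl = F.≈-trans t (proj₂ yw t (λ p → s≢t (trans s≡r′ (sym p)))) (F.≈-sym t xt)
      ... | no  j≢t  = F.≈-trans j (F.≈-sym j (proj₂ uy j j≢t)) (F.≈-sym j (xj j j≢t))
    ...   | no t≢r = ⊥-elim (Square.x≉v sq y≈v)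
      where
      t≡r′ : t ≡ r′
      t≡r′ = stepsAt-from-≉ yw λ p → ut≉wt (F.≈-trans t (proj₂ uy t t≢r) p)
      ys≈ws : F._≈_ s (y s) (w s)
      ys≈ws = proj₂ yw s (λ p → s≢t (trans p (sym t≡r′)))
      s≡r : s ≡ r
      s≡r = stepsAt-from-≉ uy λ p → us≉ws (F.≈-trans s p ys≈ws)
      y≈v : y P.≈ v
      y≈v j with j ≟ s
      ... | yes refl = F.≈-trans s ys≈ws (F.≈-sym s (proj₂ vw s s≢t))
      ... | no  j≢s  = F.≈-trans j (F.≈-sym j (proj₂ uy j (λ p → j≢s (trans p (sym s≡r)))))
                         (F.≈-sym j (proj₂ vu j j≢s))

  -- The `adjacent` clause is the contrapositive of `distinct-directions⇒square`, and the `opposite`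
  -- clause is `square-opposite`.
  δ⇒dir : ∀ {e f} → δ (□ F) e f → dir e ≡ dir f
  δ⇒dir {e} {f} (adjacent v u w ev fv u≉w n) with dir e ≟ dir f
  ... | yes p = p
  ... | no  p = ⊥-elim (n (distinct-directions⇒square p (joins⇒stepsAt e ev) (joins⇒stepsAt f fv)))
  δ⇒dir {e} {f} (opposite v u x w (sq , _) ev fx) =
    square-opposite (joins⇒stepsAt e ev) (proj₂ u~x) (joins⇒stepsAt f fx) (proj₂ w~v) u≉w x≉v
    where open Square sq
  δ⇒dir {e} {f} (equal p) = stepsAt-unique (joins⇒stepsAt e p) (joins⇒stepsAt f (joins-self (□ F) f))

  δ⁺⇒dir : ∀ {e f} → TransClosure (δ (□ F)) e f → dir e ≡ dir f
  δ⁺⇒dir [ p ]   = δ⇒dir p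
  δ⁺⇒dir (p ∷ q) = trans (δ⇒dir p) (δ⁺⇒dir q)

-- The walk first moves coordinate `zero` with the tail of `x` fixed, then the tail with the head of
-- `y` fixed. The outer adjustments are due to `∀-cons`: the rebuilt vertices agree with `x` and `y`
-- only pointwise.
□-connected : ∀ {k} (F : Fin k → Graph) → (∀ i → Connected (F i)) → Connected (□ F)
□-connected {zero}  F F-conn x y = 0 , stop λ ()
□-connected {suc k} F F-conn x y = _ ,
  walk-respˡ (□ F) (λ { zero → F.≈-refl zero ; (suc i) → F.≈-refl (suc i) })
    (walk-++ (□ F) (inHead (proj₂ (F-conn zero (x zero) (y zero))))
    (walk-++ (□ F) (inTail (proj₂ (□-connected (F ∘ suc) (F-conn ∘ suc) (x ∘ suc) (y ∘ suc))))
      (stop λ { zero → F.≈-refl zero ; (suc i) → F.≈-refl (suc i) })))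
  where
  module F i = Graph (F i)
  A : Fin (suc k) → Set
  A = F.Vertex
  inHead : ∀ {n a b} → Walk (F zero) n a b →
           Walk (□ F) n (∀-cons {P = A} a (x ∘ suc)) (∀-cons {P = A} b (x ∘ suc))
  inHead (stop p) = stop λ { zero → p ; (suc i) → F.≈-refl (suc i) }
  inHead (step a w) = step
    (zero , a , λ { zero n → ⊥-elim (n refl) ; (suc i) _ → F.≈-refl (suc i) }) (inHead w)
  inTail : ∀ {n a b} → Walk (□ (F ∘ suc)) n a b →
           Walk (□ F) n (∀-cons {P = A} (y zero) a) (∀-cons {P = A} (y zero) b)
  inTail (stop p) = stop λ { zero → F.≈-refl zero ; (suc i) → p i }
  inTail (step (i , a , q) w) = step
    (suc i , a , λ { zero _ → F.≈-refl zero ; (suc j) n → q j (n ∘ cong suc) }) (inTail w)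

-- Isomorphisms

module _ {X Y : Graph} (γ : X ≅ Y) where
  private
    module X = Graph X
    module Y = Graph Y
  open _≅_ γ

  ≅-to∘from : ∀ y → to (from y) Y.≈ y
  ≅-to∘from = Inverse.strictlyInverseˡ bijection

  ≅-from∘to : ∀ x → from (to x) X.≈ x
  ≅-from∘to = Inverse.strictlyInverseʳ bijection

  ≅-injective : ∀ {x y} → to x Y.≈ to y → x X.≈ y
  ≅-injective p = X.≈-trans (X.≈-sym (≅-from∘to _)) (X.≈-trans (from-cong p) (≅-from∘to _))

  from-preserving : ∀ {x y} → x Y.~ y → from x X.~ from y
  from-preserving a = ~-reflecting
    (proj₁ Y.~-resp (Y.≈-sym (≅-to∘from _)) (proj₂ Y.~-resp (Y.≈-sym (≅-to∘from _)) a))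

  imageEdge : Edge X → Edge Y
  imageEdge (edge x y a) = edge (to x) (to y) (~-preserving a)

  joins-image : ∀ e {x y} → Joins X e x y → Joins Y (imageEdge e) (to x) (to y)
  joins-image e (inj₁ (p , q)) = inj₁ (to-cong p , to-cong q)
  joins-image e (inj₂ (p , q)) = inj₂ (to-cong p , to-cong q)

  square-image : ∀ {v u x w} → Square X v u x w → Square Y (to v) (to u) (to x) (to w)
  square-image sq = record
    { v~u = ~-preserving v~u ; u~x = ~-preserving u~x
    ; x~w = ~-preserving x~w ; w~v = ~-preserving w~v
    ; u≉w = u≉w ∘ ≅-injective ; x≉v = x≉v ∘ ≅-injective
    ; x≉u = x≉u ∘ ≅-injective ; x≉w = x≉w ∘ ≅-injective }
    where open Square sq

  square-preimage : ∀ {v u x w} → Square Y (to v) (to u) (to x) (to w) → Square X v u x w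
  square-preimage sq = record
    { v~u = ~-reflecting v~u ; u~x = ~-reflecting u~x
    ; x~w = ~-reflecting x~w ; w~v = ~-reflecting w~v
    ; u≉w = u≉w ∘ to-cong ; x≉v = x≉v ∘ to-cong
    ; x≉u = x≉u ∘ to-cong ; x≉w = x≉w ∘ to-cong }
    where open Square sq

  -- The `adjacent` clause of `δ` contains the negation, so pulling squares back is what pushes `δ`
  -- forward in `δ-image`.
  spanUnique-preimage : ∀ {v u w} → SpanUniqueChordless Y (to v) (to u) (to w) →
                        SpanUniqueChordless X v u w
  spanUnique-preimage (x , (sq , u≁w , v≁x) , unique) =
    from x ,
    (square-preimage (square-resp Y (Y.≈-sym (≅-to∘from x)) sq) ,
     u≁w ∘ ~-preserving ,
     λ a → v≁x (proj₁ Y.~-resp (≅-to∘from x) (~-preserving a))) ,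
    λ y sq′ → ≅-injective (Y.≈-trans (unique (to y) (square-image sq′)) (Y.≈-sym (≅-to∘from x)))

  δ-image : ∀ {e f} → δ X e f → δ Y (imageEdge e) (imageEdge f)
  δ-image {e} {f} (adjacent v u w ev fv u≉w n) =
    adjacent (to v) (to u) (to w) (joins-image e ev) (joins-image f fv)
      (u≉w ∘ ≅-injective) (n ∘ spanUnique-preimage)
  δ-image {e} {f} (opposite v u x w (sq , u≁w , v≁x) ev fx) =
    opposite (to v) (to u) (to x) (to w)
      (square-image sq , u≁w ∘ ~-reflecting , v≁x ∘ ~-reflecting) (joins-image e ev) (joins-image f fx)
  δ-image {e} (equal p) = equal (joins-image e p)

  δ⁺-image : ∀ {e f} → TransClosure (δ X) e f → TransClosure (δ Y) (imageEdge e) (imageEdge f)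
  δ⁺-image [ p ]   = [ δ-image p ]
  δ⁺-image (p ∷ q) = δ-image p ∷ δ⁺-image q

≅-sym : ∀ {X Y} → X ≅ Y → Y ≅ X
≅-sym {X} {Y} γ = record
  { bijection = record
    { to = from ; from = to ; to-cong = from-cong ; from-cong = to-cong
    ; inverse = (λ p → X.≈-trans (from-cong p) (≅-from∘to γ _)) ,
                (λ p → Y.≈-trans (to-cong p) (≅-to∘from γ _)) }
  ; ~-preserving = from-preserving γ
  ; ~-reflecting = λ a → proj₁ Y.~-resp (≅-to∘from γ _)
                           (proj₂ Y.~-resp (≅-to∘from γ _) (~-preserving a))
  }
  where
  module X = Graph X
  module Y = Graph Y
  open _≅_ γ

≅-refl : ∀ {X} → X ≅ X
≅-refl = record
  { bijection = record
    { to = λ x → x ; from = λ x → x ; to-cong = λ p → p ; from-cong = λ p → p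
    ; inverse = (λ p → p) , (λ p → p) }
  ; ~-preserving = λ a → a
  ; ~-reflecting = λ a → a
  }

-- Edges of a product in a common direction

module _ {k} (F : Fin k → Graph) where
  private
    module F i = Graph (F i)
    module P = Graph (□ F)

  ≔-at : ∀ (h : P.Vertex) i {a} → F._≈_ i ((h [ i ≔ a ]) i) a
  ≔-at h i = IsEquivalence.reflexive (F.isEquivalence i) (≔-same h i)

  ≔-off : ∀ (h : P.Vertex) {i j a} → j ≢ i → F._≈_ j ((h [ i ≔ a ]) j) (h j)
  ≔-off h {j = j} n = IsEquivalence.reflexive (F.isEquivalence j) (≔-other h n)

  ≔-cong : ∀ {g h : P.Vertex} i {a b} → F._≈_ i a b → (∀ j → j ≢ i → F._≈_ j (g j) (h j)) →
           (g [ i ≔ a ]) P.≈ (h [ i ≔ b ])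
  ≔-cong {g} {h} i p q j with j ≟ i
  ... | yes refl = F.≈-trans i (≔-at g i) (F.≈-trans i p (F.≈-sym i (≔-at h i)))
  ... | no  n    = F.≈-trans j (≔-off g n) (F.≈-trans j (q j n) (F.≈-sym j (≔-off h n)))

  ≔-idem : ∀ (h : P.Vertex) i {a} → F._≈_ i (h i) a → h P.≈ (h [ i ≔ a ])
  ≔-idem h i p j with j ≟ i
  ... | yes refl = F.≈-trans i p (F.≈-sym i (≔-at h i))
  ... | no  n    = F.≈-sym j (≔-off h n)

  ≔-step : ∀ (h : P.Vertex) i {a b} → F._~_ i a b → StepsAt F i (h [ i ≔ a ]) (h [ i ≔ b ])
  ≔-step h i a~b =
    proj₁ (F.~-resp i) (F.≈-sym i (≔-at h i)) (proj₂ (F.~-resp i) (F.≈-sym i (≔-at h i)) a~b) ,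
    λ j n → F.≈-trans j (≔-off h n) (F.≈-sym j (≔-off h n))

  ≔-step-off : ∀ {g h : P.Vertex} {i j a} → j ≢ i → StepsAt F j g h →
               StepsAt F j (g [ i ≔ a ]) (h [ i ≔ a ])
  ≔-step-off {g} {h} {i} {j} n (s , q) =
    proj₁ (F.~-resp j) (F.≈-sym j (≔-off h n)) (proj₂ (F.~-resp j) (F.≈-sym j (≔-off g n)) s) , off
    where
    off : ∀ l → l ≢ j → F._≈_ l ((g [ i ≔ _ ]) l) ((h [ i ≔ _ ]) l)
    off l m with l ≟ i
    ... | yes refl = F.≈-trans i (≔-at g i) (F.≈-sym i (≔-at h i))
    ... | no  n′   = F.≈-trans l (≔-off g n′) (F.≈-trans l (q l m) (F.≈-sym l (≔-off h n′)))

  -- A translate of a factor edge: coordinate `i` of `g` is overwritten, so `g` only selects the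
  -- fibre.
  edgeAt : ∀ i (g : P.Vertex) {a b} → F._~_ i a b → Edge (□ F)
  edgeAt i g {a} {b} a~b = edge (g [ i ≔ a ]) (g [ i ≔ b ]) (i , ≔-step g i a~b)

  -- Along a walk from `g` to `h`, a step in direction `i` does not move the edge, and a step in
  -- another direction spans with it a chordless square in which the two translates are opposite.
  edgeAt-translate : Connected (□ F) → ∀ i g h {a b} (a~b : F._~_ i a b) →
                     TransClosure (δ (□ F)) (edgeAt i g a~b) (edgeAt i h a~b)
  edgeAt-translate conn i g h {a} {b} a~b =
    walk-fold (□ F) R _++_ (λ p → [ equal (inj₁ (≔-cong i (F.≈-refl i) (λ j _ → p j)
                                             , ≔-cong i (F.≈-refl i) (λ j _ → p j))) ])
      R-step (proj₂ (conn g h))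
    where
    R : Rel P.Vertex 0ℓ
    R g h = TransClosure (δ (□ F)) (edgeAt i g a~b) (edgeAt i h a~b)
    R-step : ∀ {g h} → g P.~ h → R g h
    R-step {g} {h} (j , s , q) with j ≟ i
    ... | yes refl = [ equal (inj₁ (≔-cong i (F.≈-refl i) q , ≔-cong i (F.≈-refl i) q)) ]
    ... | no  n    = [ opposite (g [ i ≔ a ]) (g [ i ≔ b ]) _ (h [ i ≔ a ])
                         (proj₁ (proj₂ span)) (joins-self (□ F) (edgeAt i g a~b))
                         (inj₂ (P.≈-refl , top≈)) ]
      where
      span : SpanUniqueChordless (□ F) (g [ i ≔ a ]) (g [ i ≔ b ]) (h [ i ≔ a ])
      span = distinct-directions⇒square F (n ∘ sym) (≔-step g i a~b) (≔-step-off n (s , q))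
      -- The top built in `span` overwrites coordinate `j` of `g [ i ≔ b ]`, whereas the translate
      -- overwrites coordinate `i` of `h`.
      top≈ : (h [ i ≔ b ]) P.≈ proj₁ span
      top≈ l with l ≟ j
      ... | yes refl = F.≈-trans j (≔-off h n) (F.≈-trans j (F.≈-sym j (≔-off h n))
                         (F.≈-sym j (≔-at (g [ i ≔ b ]) j)))
      ... | no  m with l ≟ i
      ...   | yes refl = F.≈-trans i (≔-at h i)
                           (F.≈-sym i (F.≈-trans i (≔-off (g [ i ≔ b ]) m) (≔-at g i)))
      ...   | no  n′   = F.≈-trans l (≔-off h n′) (F.≈-trans l (F.≈-sym l (q l m))
                           (F.≈-sym l (F.≈-trans l (≔-off (g [ i ≔ b ]) m) (≔-off g n′))))

-- A walk between two points that differ at `t` must contain a step moving coordinate `t`. Equality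
-- in the factor may be undecidable, so `R` records an alternative: the coordinate is unchanged so
-- far, or an edge has been found.
hasEdge : ∀ {X m} {F : Fin m → Graph} → Connected X → X ≅ □ F → Graph.Vertex (□ F) →
          ∀ t → Nontrivial (F t) → ∃[ a ] ∃[ b ] Graph._~_ (F t) a b
hasEdge {X} {m} {F} conn γ o t (x , y , x≉y) =
  [ (λ p → ⊥-elim (x≉y (F.≈-trans t (F.≈-sym t (at x)) (F.≈-trans t p (at y))))) , (λ e → e) ]′
    (walk-fold X R R-trans (λ p → inj₁ (to-cong p t)) R-step
      (proj₂ (conn (from (o [ t ≔ x ])) (from (o [ t ≔ y ])))))
  where
  module F i = Graph (F i)
  open _≅_ γ
  at : ∀ z → F._≈_ t (to (from (o [ t ≔ z ])) t) z
  at z = F.≈-trans t (≅-to∘from γ (o [ t ≔ z ]) t) (≔-at F o t)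
  R : Rel (Graph.Vertex X) 0ℓ
  R z z′ = F._≈_ t (to z t) (to z′ t) ⊎ (∃[ a ] ∃[ b ] F._~_ t a b)
  R-trans : Transitive R
  R-trans (inj₁ p) (inj₁ q) = inj₁ (F.≈-trans t p q)
  R-trans (inj₁ p) (inj₂ e) = inj₂ e
  R-trans (inj₂ e) _        = inj₂ e
  R-step : ∀ {z z′} → Graph._~_ X z z′ → R z z′
  R-step a with ~-preserving a
  ... | i , b , q with t ≟ i
  ...   | yes refl = inj₂ (_ , _ , b)
  ...   | no  n    = inj₁ (q t n)

-- Uniqueness of the prime factorization

module _ {k} (F : Fin k → Graph) (o : Graph.Vertex (□ F)) (connected : Connected (□ F))
         (anEdge : ∀ i → ∃[ a ] ∃[ b ] Graph._~_ (F i) a b)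
         (parallel : ∀ e f → dir F e ≡ dir F f → TransClosure (δ (□ F)) e f)
         (D : PrimeFactorization (□ F)) where
  open PrimeFactorization D
  open _≅_ iso using (to; from; to-cong; from-cong; ~-preserving)
  private
    module F i = Graph (F i)
    module P = Graph (□ F)
    module B i = Graph (factor i)
    module Q = Graph (□ factor)

  edgeAlong : ∀ i → Edge (□ F)
  edgeAlong i = let (_ , _ , a~b) = anEdge i in edgeAt F i o a~b

  -- δ-related edges of □ F lie in the same direction of any factorization, so
  -- each factor of □ F is contained in one prime factor.
  primeOf : Fin k → Fin size
  primeOf i = dir factor (imageEdge iso (edgeAlong i))

  dir-image : ∀ e → dir factor (imageEdge iso e) ≡ primeOf (dir F e)
  dir-image e = δ⁺⇒dir factor (δ⁺-image iso (parallel e (edgeAlong (dir F e)) refl))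

  image-off : ∀ {i x y s} → StepsAt F i x y → s ≢ primeOf i → B._≈_ s (to x s) (to y s)
  image-off {i} {x} {y} {s} st n = proj₂ (proj₂ (~-preserving (i , st))) s
    (λ p → n (trans p (dir-image (edge x y (i , st)))))

  base : Q.Vertex
  base = to o

  -- The layer of a prime factor through the base vertex

  module _ (t : Fin size) where

    layer : B.Vertex t → Q.Vertex
    layer y = base [ t ≔ y ]

    lift : B.Vertex t → P.Vertex
    lift y = from (layer y)

    layer-cong : ∀ {y y′} → B._≈_ t y y′ → layer y Q.≈ layer y′
    layer-cong p = ≔-cong factor t p (λ s _ → B.≈-refl s)

    layer-step : ∀ {y y′} → B._~_ t y y′ → StepsAt factor t (layer y) (layer y′)
    layer-step = ≔-step factor base t

    lift-cong : ∀ {y y′} → B._≈_ t y y′ → lift y P.≈ lift y′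
    lift-cong p = from-cong (layer-cong p)

    to-lift : ∀ y → to (lift y) Q.≈ layer y
    to-lift y = ≅-to∘from iso (layer y)

    to-lift-at : ∀ y → B._≈_ t (to (lift y) t) y
    to-lift-at y = B.≈-trans t (to-lift y t) (≔-at factor base t)

    lift-preserving : ∀ {y y′} → B._~_ t y y′ → lift y P.~ lift y′
    lift-preserving a = from-preserving iso (t , layer-step a)

    lift-reflecting : ∀ {y y′} → lift y P.~ lift y′ → B._~_ t y y′
    lift-reflecting {y} {y′} a with proj₁ Q.~-resp (to-lift y′) (proj₂ Q.~-resp (to-lift y) (~-preserving a))
    ... | s , b , _ with s ≟ t
    ...   | yes refl = proj₁ (B.~-resp t) (≔-at factor base t) (proj₂ (B.~-resp t) (≔-at factor base t) b)
    ...   | no  n    = ⊥-elim (B.~-irrefl s (B.≈-trans s (≔-off factor base n) (B.≈-sym s (≔-off factor base n))) b)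

    lift-direction : ∀ {y y′} (a : lift y P.~ lift y′) → t ≡ primeOf (proj₁ a)
    lift-direction {y} {y′} a = trans
      (stepsAt-unique factor
        (layer-step (lift-reflecting a))
        (proj₂ (proj₁ Q.~-resp (to-lift y′) (proj₂ Q.~-resp (to-lift y) (~-preserving a)))))
      (dir-image (edge _ _ a))

    -- Sending `g` to `lift (to g t)` retracts `□ F` onto the layer. Along a walk from `o` to
    -- `lift y`, each step is either collapsed by this map or becomes a step in a direction grouped
    -- into `t`, so coordinate `l` never changes.
    lift-off : ∀ y {l} → primeOf l ≢ t → F._≈_ l (lift y l) (o l)
    lift-off y {l} n = F.≈-sym l (F.≈-trans l (F.≈-sym l (lift-base l))
      (F.≈-trans l
        (walk-fold (□ F) R (F.≈-trans l) (λ p → lift-cong (to-cong p t) l) R-step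
          (proj₂ (connected o (lift y))))
        (lift-cong (to-lift-at y) l)))
      where
      R : Rel P.Vertex 0ℓ
      R g g′ = F._≈_ l (lift (to g t) l) (lift (to g′ t) l)
      R-step : ∀ {g g′} → g P.~ g′ → R g g′
      R-step a with ~-preserving a
      ... | s , b , off with t ≟ s
      ...   | no m     = lift-cong (off t m) l
      ...   | yes refl = proj₂ (proj₂ c) l (λ p → n (trans (cong primeOf p) (sym (lift-direction c))))
        where c = lift-preserving b
      lift-base : lift (to o t) P.≈ o
      lift-base = P.≈-trans (from-cong (Q.≈-sym (≔-idem factor base t (B.≈-refl t)))) (≅-from∘to iso o)

    -- The projection onto the subproduct, through `o`, of the directions grouped into `t`.
    mask : P.Vertex → P.Vertex
    mask h l with primeOf l ≟ t
    ... | yes _ = h l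
    ... | no  _ = o l

    mask-≈ : ∀ h → (∀ l → primeOf l ≢ t → F._≈_ l (h l) (o l)) → mask h P.≈ h
    mask-≈ h off l with primeOf l ≟ t
    ... | yes _ = F.≈-refl l
    ... | no  n = F.≈-sym l (off l n)

    mask-cong : ∀ {h h′} l → (primeOf l ≡ t → F._≈_ l (h l) (h′ l)) → F._≈_ l (mask h l) (mask h′ l)
    mask-cong l p with primeOf l ≟ t
    ... | yes q = p q
    ... | no  _ = F.≈-refl l

    mask-step : ∀ {i h h′} → primeOf i ≡ t → StepsAt F i h h′ → StepsAt F i (mask h) (mask h′)
    mask-step {i} {h} {h′} q (a , off) = at , λ j n → mask-cong j (λ _ → off j n)
      where
      at : F._~_ i (mask h i) (mask h′ i)
      at with primeOf i ≟ t
      ... | yes _ = a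
      ... | no  n = ⊥-elim (n q)

    -- Masking a walk from o to g leaves only steps in directions grouped into t.
    to-off : ∀ g → (∀ l → primeOf l ≢ t → F._≈_ l (g l) (o l)) → ∀ {s} → s ≢ t → B._≈_ s (to g s) (base s)
    to-off g off {s} m = B.≈-sym s (B.≈-trans s (B.≈-sym s (to-cong (mask-≈ o (λ l _ → F.≈-refl l)) s))
      (B.≈-trans s
        (walk-fold (□ F) R (B.≈-trans s) (λ p → to-cong (λ l → mask-cong l (λ _ → p l)) s) R-step
          (proj₂ (connected o g)))
        (to-cong (mask-≈ g off) s)))
      where
      R : Rel P.Vertex 0ℓ
      R h h′ = B._≈_ s (to (mask h) s) (to (mask h′) s)
      R-step : ∀ {h h′} → h P.~ h′ → R h h′
      R-step (i , a , q) with primeOf i ≟ t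
      ... | yes p = image-off (mask-step p (a , q)) (λ e → m (trans e p))
      ... | no  n = to-cong (λ l → mask-cong l (λ e → q l (λ { refl → n e }))) s

    -- By `to-off`, `to g` agrees with the base outside `t`. Together with `lift-off` this
    -- identifies the layer with the subproduct of the directions grouped into `t`.
    lift-to : ∀ g → (∀ l → primeOf l ≢ t → F._≈_ l (g l) (o l)) → lift (to g t) P.≈ g
    lift-to g off = P.≈-trans (from-cong layer-to) (≅-from∘to iso g)
      where
      layer-to : layer (to g t) Q.≈ to g
      layer-to s with s ≟ t
      ... | yes refl = ≔-at factor base t
      ... | no  m    = B.≈-trans s (≔-off factor base m) (B.≈-sym s (to-off g off m))

    separate : ∀ {i l} → primeOf i ≡ t → primeOf l ≢ t → l ≢ i
    separate i∈t n refl = n i∈t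

    -- Splitting one direction off a prime factor

    module _ (i : Fin k) (i∈t : primeOf i ≡ t) where

      -- The subproduct of the other directions in the group of `i`: everything outside the group is
      -- pinned to `o`, and so is coordinate `i`.
      Rest : Pred P.Vertex 0ℓ
      Rest h = F._≈_ i (h i) (o i) × (∀ l → primeOf l ≢ t → F._≈_ l (h l) (o l))

      pieces : Fin 2 → Graph
      pieces zero       = F i
      pieces (suc zero) = ⟨_⟩ (□ F) Rest

      reset : P.Vertex → P.Vertex
      reset h = h [ i ≔ o i ]

      restOf : B.Vertex t → Σ[ h ∈ P.Vertex ] Rest h
      restOf y = reset (lift y) , ≔-at F (lift y) i ,
        λ l n → F.≈-trans l (≔-off F (lift y) (separate i∈t n)) (lift-off y n)

      break : B.Vertex t → Graph.Vertex (□ pieces)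
      break y zero       = lift y i
      break y (suc zero) = restOf y

      glue : Graph.Vertex (□ pieces) → P.Vertex
      glue z = proj₁ (z (suc zero)) [ i ≔ z zero ]

      glue-off : ∀ z l → primeOf l ≢ t → F._≈_ l (glue z l) (o l)
      glue-off z l n = F.≈-trans l (≔-off F (proj₁ (z (suc zero))) (separate i∈t n))
                         (proj₂ (proj₂ (z (suc zero))) l n)

      glue-cong : ∀ {z z′} → Graph._≈_ (□ pieces) z z′ → glue z P.≈ glue z′
      glue-cong p = ≔-cong F i (p zero) (λ l _ → p (suc zero) l)

      break-cong : ∀ {y y′} → B._≈_ t y y′ → Graph._≈_ (□ pieces) (break y) (break y′)
      break-cong p zero       = lift-cong p i
      break-cong p (suc zero) = ≔-cong F i (F.≈-refl i) (λ l _ → lift-cong p l)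

      glue-break : ∀ y → glue (break y) P.≈ lift y
      glue-break y l with l ≟ i
      ... | yes refl = ≔-at F (reset (lift y)) i
      ... | no  n    = F.≈-trans l (≔-off F (reset (lift y)) n) (≔-off F (lift y) n)

      -- Members of `Rest` are already pinned at `i`, so resetting that coordinate after gluing
      -- recovers them.
      unglue : ∀ z {h} → h P.≈ glue z → reset h P.≈ proj₁ (z (suc zero))
      unglue z {h} p l with l ≟ i
      ... | yes refl = F.≈-trans i (≔-at F h i) (F.≈-sym i (proj₁ (proj₂ (z (suc zero)))))
      ... | no  n    = F.≈-trans l (≔-off F h n) (F.≈-trans l (p l) (≔-off F (proj₁ (z (suc zero))) n))

      break-glue : ∀ z → Graph._≈_ (□ pieces) (break (to (glue z) t)) z
      break-glue z zero       = F.≈-trans i (lift-to (glue z) (glue-off z) i) (≔-at F (proj₁ (z (suc zero))) i)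
      break-glue z (suc zero) = unglue z (lift-to (glue z) (glue-off z))

      break-preserving : ∀ {y y′} → B._~_ t y y′ → Graph._~_ (□ pieces) (break y) (break y′)
      break-preserving {y} {y′} a with lift-preserving a
      ... | l , b , q with l ≟ i
      ...   | yes refl = zero , b , λ { zero n → ⊥-elim (n refl) ; (suc zero) _ → ≔-cong F i (F.≈-refl i) q }
      ...   | no  n    = suc zero , (l , ≔-step-off F n (b , q)) ,
                         λ { zero _ → q i (n ∘ sym) ; (suc zero) m → ⊥-elim (m refl) }

      glue-preserving : ∀ {z z′} → Graph._~_ (□ pieces) z z′ → glue z P.~ glue z′
      glue-preserving {z} {z′} (zero , a , q) = proj₁ P.~-resp
        (≔-cong F i (F.≈-refl i) λ l _ → q (suc zero) (λ ()) l)
        (i , ≔-step F (proj₁ (z (suc zero))) i a)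
      glue-preserving {z} {z′} (suc zero , (l , a , q) , r) = proj₁ P.~-resp
        (≔-cong F i (r zero (λ ())) λ j _ → F.≈-refl j)
        (l , ≔-step-off F l≢i (a , q))
        where
        -- Both ends lie in `Rest` and are pinned at `i`, so no step between them moves that
        -- coordinate.
        l≢i : l ≢ i
        l≢i refl = F.~-irrefl i (F.≈-trans i (proj₁ (proj₂ (z (suc zero))))
                                  (F.≈-sym i (proj₁ (proj₂ (z′ (suc zero)))))) a

      factor≅pieces : factor t ≅ □ pieces
      factor≅pieces = record
        { bijection = record
          { to        = break
          ; from      = λ z → to (glue z) t
          ; to-cong   = break-cong
          ; from-cong = λ p → to-cong (glue-cong p) t
          ; inverse   =
              (λ {z} p → Graph.≈-trans (□ pieces) (break-cong p) (break-glue z)) ,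
              (λ {y} p → B.≈-trans t (to-cong (P.≈-trans (glue-cong p) (glue-break y)) t) (to-lift-at y))
          }
        ; ~-preserving = break-preserving
        ; ~-reflecting = λ {y} {y′} a → lift-reflecting
            (proj₁ P.~-resp (glue-break y′) (proj₂ P.~-resp (glue-break y) (glue-preserving a)))
        }

      pieces-nontrivial : ∀ j → j ≢ i → primeOf j ≡ t → Nontrivial (⟨_⟩ (□ F) Rest)
      pieces-nontrivial j j≢i j∈t =
        let (a , b , a~b) = anEdge j in at a , at b ,
        λ p → F.~-irrefl j (F.≈-trans j (F.≈-sym j (≔-at F o j)) (F.≈-trans j (p j) (≔-at F o j))) a~b
        where
        at : F.Vertex j → Σ[ h ∈ P.Vertex ] Rest h
        at c = o [ j ≔ c ] , ≔-off F o (j≢i ∘ sym) , λ l n → ≔-off F o (separate j∈t n)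

  -- A second direction in the group of `i` would make both pieces nontrivial, contradicting the
  -- primality of their product.
  primeOf-injective : ∀ i j → primeOf i ≡ primeOf j → i ≡ j
  primeOf-injective i j p with i ≟ j
  ... | yes q = q
  ... | no  i≢j = ⊥-elim (proj₂ (prime (primeOf i)) (pieces (primeOf i) i refl)
    (factor≅pieces (primeOf i) i refl)
    ((proj₁ (anEdge i) , proj₁ (proj₂ (anEdge i)) , λ q → F.~-irrefl i q (proj₂ (proj₂ (anEdge i)))) ,
     pieces-nontrivial (primeOf i) i refl j (i≢j ∘ sym) (sym p)))

  same-factor⇒same-dir : ∀ {s} e f → DifferAt s e → DifferAt s f → dir F e ≡ dir F f
  same-factor⇒same-dir e f p q = primeOf-injective _ _
    (trans (sym (factorOf e p)) (factorOf f q))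
    where
    factorOf : ∀ {s} e → DifferAt s e → s ≡ primeOf (dir F e)
    factorOf {s} e p = trans
      (stepsAt-from-≉ factor (proj₂ (Edge.adjacent (imageEdge iso e))) p) (dir-image e)

-- Stars

record IsStar (X : Graph) : Set where
  open Graph X
  field
    hub    : Vertex
    _≈?_   : Decidable _≈_
    spoke  : ∀ {x} → ¬ x ≈ hub → hub ~ x
    hub∈   : ∀ {x y} → x ~ y → x ≈ hub ⊎ y ≈ hub

  leaf~⇒hub : ∀ {x y} → ¬ x ≈ hub → x ~ y → y ≈ hub
  leaf~⇒hub x≉ a = [ (λ p → ⊥-elim (x≉ p)) , (λ q → q) ]′ (hub∈ a)

  hub~⇒leaf : ∀ {x y} → x ≈ hub → x ~ y → ¬ y ≈ hub
  hub~⇒leaf p a q = ~-irrefl (≈-trans p (≈-sym q)) a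

  star-connected : Connected X
  star-connected x y = _ , walk-++ X (walk-reverse X (proj₂ (out x))) (proj₂ (out y))
    where
    out : ∀ z → ∃[ n ] Walk X n hub z
    out z with z ≈? hub
    ... | yes p = 0 , stop (≈-sym p)
    ... | no  n = 1 , step (spoke n) (stop ≈-refl)

  -- Every edge has the hub as an end, so two opposite corners would both be the hub: `v` and `x` if
  -- `v` is the hub, and `u` and `w` otherwise.
  star-no-square : ∀ {v u x w} → ¬ Square X v u x w
  star-no-square {v} {u} {x} {w} sq with v ≈? hub
  ... | yes p = x≉v (≈-trans (leaf~⇒hub (hub~⇒leaf p v~u) u~x) (≈-sym p))
    where open Square sq
  ... | no  n = u≉w (≈-trans (leaf~⇒hub n v~u) (≈-sym (leaf~⇒hub n (~-sym w~v))))
    where open Square sq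

  -- Each of two nontrivial factors would contain an edge by `hasEdge`. Two edges in different
  -- directions span a square, which the inverse isomorphism carries into the star.
  star-prime : ∀ {a b} → a ~ b → Prime X
  star-prime {a} {b} a~b = (a , b , λ p → ~-irrefl p a~b) , λ F γ (nt₀ , nt₁) →
    let o = _≅_.to γ hub
        (a₀ , b₀ , s₀) = hasEdge {F = F} star-connected γ o zero nt₀
        (a₁ , b₁ , s₁) = hasEdge {F = F} star-connected γ o (suc zero) nt₁
        g = o [ zero ≔ a₀ ]
        (_ , (sq , _) , _) = distinct-directions⇒square F (λ ())
          (≔-step-off F {g = g} {i = suc zero} {j = zero} {a = a₁} (λ ()) (≔-step F o zero s₀))
          (≔-step F g (suc zero) s₁)
    in star-no-square (square-image (≅-sym γ) sq)

-- Products of stars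

module StarProducts {k} (F : Fin k → Graph) (star : ∀ i → IsStar (F i)) where
  private
    module F i = Graph (F i)
    module P = Graph (□ F)
    module St i = IsStar (star i)

  hubs : P.Vertex
  hubs = St.hub

  □-stars-connected : Connected (□ F)
  □-stars-connected = □-connected F St.star-connected

  -- A normal form oriented away from the hub; `_≈ᴱ_` absorbs the case in which `e` is written
  -- towards the hub.
  data SpokeFrom (i : Fin k) (e : Edge (□ F)) : Set where
    spokeFrom : ∀ {a} (s : F._~_ i (hubs i) a) → _≈ᴱ_ (□ F) e (edgeAt F i (Edge.src e) s) → SpokeFrom i e

  spokeOf : ∀ e → SpokeFrom (dir F e) e
  spokeOf (edge x y (i , s , q)) with St.hub∈ i s
  ... | inj₁ p = spokeFrom (proj₂ (F.~-resp i) p s)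
    (inj₁ (≔-idem F x i p , P.≈-trans (≔-idem F y i (F.≈-refl i))
                              (≔-cong F i (F.≈-refl i) λ j n → F.≈-sym j (q j n))))
  ... | inj₂ p = spokeFrom (F.~-sym i (proj₁ (F.~-resp i) p s))
    (inj₂ (≔-idem F x i (F.≈-refl i) , P.≈-trans (≔-idem F y i p)
                              (≔-cong F i (F.≈-refl i) λ j n → F.≈-sym j (q j n))))

  -- Opposite sides of a square have the same direction, so `u` and `x` differ along `i`. There `u`
  -- is a leaf, whose only neighbour is the hub, which makes `x` equal to `v`.
  no-square-along : ∀ {v u x w i} → F._≈_ i (v i) (hubs i) → StepsAt F i v u → StepsAt F i v w →
                    ¬ Square (□ F) v u x w
  no-square-along {v} {u} {x} {w} {i} p vu vw sq = x≉v λ j → x≈v j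
    where
    open Square sq
    x-along : proj₁ u~x ≡ i
    x-along = trans
      (square-opposite F (proj₂ u~x) (proj₂ x~w) (proj₂ w~v) (proj₂ v~u) x≉v (λ q → u≉w (P.≈-sym q)))
      (stepsAt-unique F (proj₂ w~v) (stepsAt-sym F vw))
    ux : StepsAt F i u x
    ux = subst (λ r → StepsAt F r u x) x-along (proj₂ u~x)
    x≈v : ∀ j → F._≈_ j (x j) (v j)
    x≈v j with j ≟ i
    ... | yes refl = F.≈-trans i (St.leaf~⇒hub i (St.hub~⇒leaf i p (proj₁ vu)) (proj₁ ux)) (F.≈-sym i p)
    ... | no  n    = F.≈-trans j (F.≈-sym j (proj₂ ux j n)) (F.≈-sym j (proj₂ vu j n))

  spokes-related : ∀ i g {a b} (s : F._~_ i (hubs i) a) (t : F._~_ i (hubs i) b) →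
                   δ (□ F) (edgeAt F i g s) (edgeAt F i g t)
  spokes-related i g {a} {b} s t with St._≈?_ i a b
  ... | yes p = equal (inj₁ (P.≈-refl , ≔-cong F i p (λ j _ → F.≈-refl j)))
  ... | no  n = adjacent (g [ i ≔ hubs i ]) (g [ i ≔ a ]) (g [ i ≔ b ])
    (joins-self (□ F) (edgeAt F i g s)) (joins-self (□ F) (edgeAt F i g t))
    (λ p → n (F.≈-trans i (F.≈-sym i (≔-at F g i)) (F.≈-trans i (p i) (≔-at F g i))))
    λ (x , (sq , _) , _) → no-square-along (≔-at F g i) (≔-step F g i s) (≔-step F g i t) sq

  -- The chain normalizes `e` to a spoke, translates it to the fibre of `f`, exchanges it for the
  -- spoke of `f` there, and undoes the normalization.
  parallel : ∀ e f → dir F e ≡ dir F f → TransClosure (δ (□ F)) e f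
  parallel e f eq with spokeOf e | spokeOf f
  ... | spokeFrom s p | spokeFrom t q rewrite eq =
    equal p ∷ (edgeAt-translate F □-stars-connected (dir F f) (Edge.src e) (Edge.src f) s ++
    (spokes-related (dir F f) (Edge.src f) s t ∷ [ equal (≈ᴱ-sym (□ F) f (edgeAt F (dir F f) (Edge.src f) t) q) ]))

  -- Retracting leaf coordinates along walks

  _≈?_ : Decidable P._≈_
  x ≈? y = all? λ i → St._≈?_ i (x i) (y i)

  retract : P.Vertex → Fin k → P.Vertex
  retract x i = x [ i ≔ hubs i ]

  ~retract : ∀ x {i} → ¬ F._≈_ i (x i) (hubs i) → x P.~ retract x i
  ~retract x {i} n = i , stepsAt-sym F
    (proj₂ (F.~-resp i) (F.≈-sym i (≔-at F x i)) (St.spoke i n) , λ j → ≔-off F x)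

  -- The walk leaves x i through the hub of the i-th star; making that step
  -- first saves it later on.
  walk-retract : ∀ {n x y i} → Walk (□ F) n x y →
               ¬ F._≈_ i (x i) (hubs i) → ¬ F._≈_ i (x i) (y i) →
               ∃[ m ] m < n × Walk (□ F) m (retract x i) y
  walk-retract {i = i} (stop p) _ x≉y = ⊥-elim (x≉y (p i))
  walk-retract {x = x} {i = i} (step {n = n} {y = z} (j , s , q) w) leaf x≉y with i ≟ j
  ... | yes refl = n , n<1+n n , walk-respˡ (□ F)
    (P.≈-trans (≔-idem F z i (St.leaf~⇒hub i leaf s)) (≔-cong F i (F.≈-refl i) λ l m → F.≈-sym l (q l m))) w
  ... | no  i≢j with walk-retract {x = z} {i = i} w (λ p → leaf (F.≈-trans i (q i i≢j) p))
                       (λ p → x≉y (F.≈-trans i (q i i≢j) p))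
  ...   | m , m<n , w′ = suc m , s≤s m<n , step (j , ≔-step-off F (i≢j ∘ sym) (s , q)) w′

  -- At a coordinate where the ends differ, at least one end is a leaf. Retracting that end stays in
  -- `R` and costs one step, while `walk-retract` saves at least one on the rest, so the length does
  -- not grow. The bound `N` drives the recursion because the shortened walk is not a subterm.
  walk-inside : (R : Pred P.Vertex 0ℓ) → (∀ x i → R x → R (retract x i)) →
                ∀ N {n} (x y : Σ[ z ∈ P.Vertex ] R z) → n ≤ N → Walk (□ F) n (proj₁ x) (proj₁ y) →
                ∃[ m ] m ≤ n × Walk (⟨_⟩ (□ F) R) m x y
  walk-inside R R-retract N (x , rx) (y , ry) n≤N w with x ≈? y
  ... | yes p = 0 , z≤n , stop p
  ... | no x≉y with ¬∀⟶∃¬ k (λ i → F._≈_ i (x i) (y i)) (λ i → St._≈?_ i (x i) (y i)) x≉y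
  walk-inside R R-retract zero (x , rx) (y , ry) z≤n (stop p) | no x≉y | _ = ⊥-elim (x≉y p)
  walk-inside R R-retract (suc N) {n} (x , rx) (y , ry) n≤N w | no x≉y | i , xi≉yi with St._≈?_ i (x i) (hubs i)
  ... | no leaf =
    let (m , m<n , w′) = walk-retract w leaf xi≉yi
        (l , l≤m , w″) = walk-inside R R-retract N (retract x i , R-retract x i rx) (y , ry)
                           (≤-pred (≤-trans m<n n≤N)) w′
    in suc l , ≤-trans (s≤s l≤m) m<n , step (~retract x leaf) w″
  -- Here `y` is the end with the leaf, so the walk is reversed before it is shortened.
  ... | yes p =
    let leaf = λ q → xi≉yi (F.≈-trans i p (F.≈-sym i q))
        (m , m<n , w′) = walk-retract (walk-reverse (□ F) w) leaf (xi≉yi ∘ F.≈-sym i)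
        (l , l≤m , w″) = walk-inside R R-retract N (x , rx) (retract y i , R-retract y i ry)
                           (≤-pred (≤-trans m<n n≤N)) (walk-reverse (□ F) w′)
    in suc l , ≤-trans (s≤s l≤m) m<n ,
       walk-snoc (⟨_⟩ (□ F) R) w″ (P.~-sym (~retract y leaf))

  -- The ball of radius two about the hubs

  data Sparse (x : P.Vertex) : Set where
    none : (∀ j → F._≈_ j (x j) (hubs j)) → Sparse x
    one : ∀ i → ¬ F._≈_ i (x i) (hubs i) → (∀ j → j ≢ i → F._≈_ j (x j) (hubs j)) → Sparse x
    two : ∀ i j → i ≢ j → ¬ F._≈_ i (x i) (hubs i) → ¬ F._≈_ j (x j) (hubs j) →
             (∀ l → l ≢ i → l ≢ j → F._≈_ l (x l) (hubs l)) → Sparse x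

  walk⇒sparse : ∀ {n x} → n ≤ 2 → Walk (□ F) n hubs x → Sparse x
  walk⇒sparse _ (stop p) = none (λ j → F.≈-sym j (p j))
  walk⇒sparse _ (step (i , s , q) (stop p)) = one i
    (λ r → St.hub~⇒leaf i (F.≈-refl i) s (F.≈-trans i (p i) r))
    (λ j n → F.≈-sym j (F.≈-trans j (q j n) (p j)))
  walk⇒sparse {x = x} _ (step (i , s , q) (step (j , t , r) (stop p))) with i ≟ j
  -- A second step in the same direction can only return from the leaf to the hub.
  ... | yes refl = none x≈hubs
    where
    x≈hubs : ∀ l → F._≈_ l (x l) (hubs l)
    x≈hubs l with l ≟ i
    ... | yes refl = F.≈-trans i (F.≈-sym i (p i)) (St.leaf~⇒hub i (St.hub~⇒leaf i (F.≈-refl i) s) t)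
    ... | no  n    = F.≈-sym l (F.≈-trans l (q l n) (F.≈-trans l (r l n) (p l)))
  ... | no i≢j = two i j i≢j
    (λ e → St.hub~⇒leaf i (F.≈-refl i) s (F.≈-trans i (r i i≢j) (F.≈-trans i (p i) e)))
    (λ e → St.hub~⇒leaf j (F.≈-sym j (q j (i≢j ∘ sym))) t (F.≈-trans j (p j) e))
    (λ l m n → F.≈-sym l (F.≈-trans l (q l m) (F.≈-trans l (r l n) (p l))))
  walk⇒sparse (s≤s (s≤s ())) (step _ (step _ (step _ _)))

  retract-single : ∀ {x i} → (∀ j → j ≢ i → F._≈_ j (x j) (hubs j)) → retract x i P.≈ hubs
  retract-single {x} {i} off j with j ≟ i
  ... | yes refl = ≔-at F x i
  ... | no  n    = F.≈-trans j (≔-off F x n) (off j n)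

  -- The number of leaf coordinates is the distance from the hubs: one step reaches each leaf, and a
  -- step moves only one coordinate.
  sparse⇒N₂ : ∀ {x} → Sparse x → N₂[_] (□ F) hubs x
  sparse⇒N₂ (none p) = 0 , (stop (λ j → F.≈-sym j (p j)) , λ _ _ → z≤n) , z≤n
  sparse⇒N₂ {x} (one i leaf off) = 1 , (w , minimal) , s≤s z≤n
    where
    w : Walk (□ F) 1 hubs x
    w = step (proj₂ P.~-resp (retract-single off) (P.~-sym (~retract x leaf))) (stop P.≈-refl)
    minimal : ∀ m → Walk (□ F) m hubs x → 1 ≤ m
    minimal _ (stop p)   = ⊥-elim (leaf (F.≈-sym i (p i)))
    minimal _ (step _ _) = s≤s z≤n
  sparse⇒N₂ {x} (two i j i≢j leafᵢ leafⱼ off) = 2 , (w , minimal) , s≤s (s≤s z≤n)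
    where
    z : P.Vertex
    z = retract x i
    z-off : ∀ l → l ≢ j → F._≈_ l (z l) (hubs l)
    z-off l n with l ≟ i
    ... | yes refl = ≔-at F x i
    ... | no  m    = F.≈-trans l (≔-off F x m) (off l m n)
    w : Walk (□ F) 2 hubs x
    w = step (proj₂ P.~-resp (retract-single z-off)
               (P.~-sym (~retract z (λ p → leafⱼ (F.≈-trans j (F.≈-sym j (≔-off F x (i≢j ∘ sym))) p)))))
        (step (P.~-sym (~retract x leafᵢ)) (stop P.≈-refl))
    minimal : ∀ m → Walk (□ F) m hubs x → 2 ≤ m
    minimal _ (stop p)                 = ⊥-elim (leafᵢ (F.≈-sym i (p i)))
    minimal _ (step (r , s , q) (stop p)) = ⊥-elim (i≢j (trans
      (stepsAt-from-≉ F (s , q) (λ e → leafᵢ (F.≈-sym i (F.≈-trans i e (p i)))))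
      (sym (stepsAt-from-≉ F (s , q) (λ e → leafⱼ (F.≈-sym j (F.≈-trans j e (p j))))))))
    minimal _ (step _ (step _ _))      = s≤s (s≤s z≤n)

  N₂⇒sparse : ∀ {x} → N₂[_] (□ F) hubs x → Sparse x
  N₂⇒sparse (n , (w , _) , n≤2) = walk⇒sparse n≤2 w

  N₂-retract : ∀ x i → N₂[_] (□ F) hubs x → N₂[_] (□ F) hubs (retract x i)
  N₂-retract x i (n , (w , _) , n≤2) with St._≈?_ i (x i) (hubs i)
  ... | yes p = sparse⇒N₂ (walk⇒sparse n≤2 (walk-reverse (□ F) (walk-respˡ (□ F) (≔-idem F x i p) (walk-reverse (□ F) w))))
  -- The reversed walk ends at the hubs, so the two side conditions of `walk-retract` coincide and
  -- `p` serves for both.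
  ... | no  p = let (m , m<n , w′) = walk-retract (walk-reverse (□ F) w) p p in
    sparse⇒N₂ (walk⇒sparse (≤-trans (≤-pred (≤-trans m<n n≤2)) (s≤s z≤n)) (walk-reverse (□ F) w′))

  ball-isometric : ∀ {n} (x y : Σ[ z ∈ P.Vertex ] N₂[_] (□ F) hubs z) → Walk (□ F) n (proj₁ x) (proj₁ y) →
                   ∃[ m ] m ≤ n × Walk (⟨_⟩ (□ F) (N₂[_] (□ F) hubs)) m x y
  ball-isometric {n} x y = walk-inside (N₂[_] (□ F) hubs) N₂-retract n x y ≤-refl

-- The partial star product

module StarProductAt (Γ : FinGraph) (v : Graph.Vertex (FinGraph.graph Γ)) (k : ℕ)
       (φ : Fin k → Pred (Edge (FinGraph.graph Γ)) 0ℓ)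
       (enumerates : Enumerates (FinGraph.graph Γ) v φ) where

  open FinGraph Γ using (_~_; ~-dec; ~-sym; ~-irrefl) renaming (graph to G)
  open Enumerates enumerates
  V : Set
  V = Graph.Vertex G

  ~⇒≢ : ∀ {x y} → x ~ y → x ≢ y
  ~⇒≢ a refl = ~-irrefl a

  square? : ∀ u a x b → Dec (Square G u a x b)
  square? u a x b = map′
    (λ (p , q , r , s , t , l , m , n) → record
      { v~u = p ; u~x = q ; x~w = r ; w~v = s ; u≉w = t ; x≉v = l ; x≉u = m ; x≉w = n })
    (λ sq → let open Square sq in v~u , u~x , x~w , w~v , u≉w , x≉v , x≉u , x≉w)
    (~-dec u a ×-dec ~-dec a x ×-dec ~-dec x b ×-dec ~-dec b u ×-dec
     ¬? (a ≟ b) ×-dec ¬? (x ≟ u) ×-dec ¬? (x ≟ a) ×-dec ¬? (x ≟ b))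

  -- The `adjacent` clause of `δ` contains a negation, so from unrelated edges alone the square
  -- would be obtained only up to double negation; finiteness of the vertex set supplies the
  -- decision.
  spanUnique? : ∀ u a b → Dec (SpanUniqueChordless G u a b)
  spanUnique? u a b = any? λ x →
    (square? u a x b ×-dec ¬? (~-dec a b) ×-dec ¬? (~-dec u x)) ×-dec
    all? λ y → square? u a y b →-dec (y ≟ x)

  chordless-flip : ∀ {u a x b} → ChordlessSquare G u a x b → ChordlessSquare G u b x a
  chordless-flip (sq , a≁b , u≁x) = record
    { v~u = ~-sym w~v ; u~x = ~-sym x~w ; x~w = ~-sym u~x ; w~v = ~-sym v~u
    ; u≉w = u≉w ∘ sym ; x≉v = x≉v ; x≉u = x≉w ; x≉w = x≉u } , a≁b ∘ ~-sym , u≁x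
    where open Square sq

  incident-joins : ∀ e {x} → Incident G x e → ∃[ y ] Joins G e x y
  incident-joins (edge x y _) (inj₁ p) = y , inj₁ (p , refl)
  incident-joins (edge x y _) (inj₂ p) = x , inj₂ (refl , p)

  joins-incident : ∀ e {x y} → Joins G e x y → Incident G x e
  joins-incident e (inj₁ (p , _)) = inj₁ p
  joins-incident e (inj₂ (_ , p)) = inj₂ p

  joins-~ : ∀ e {x y} → Joins G e x y → x ~ y
  joins-~ e = S.joins⇒~ G v e

  joins-ends : ∀ e {x y a b} → Joins G e x y → Joins G e a b → (x ≡ a × y ≡ b) ⊎ (x ≡ b × y ≡ a)
  joins-ends e (inj₁ (refl , refl)) (inj₁ (refl , refl)) = inj₁ (refl , refl)
  joins-ends e (inj₁ (refl , refl)) (inj₂ (refl , refl)) = inj₂ (refl , refl)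
  joins-ends e (inj₂ (refl , refl)) (inj₁ (refl , refl)) = inj₂ (refl , refl)
  joins-ends e (inj₂ (refl , refl)) (inj₂ (refl , refl)) = inj₁ (refl , refl)

  -- Classes of 𝔡*

  infix 4 _≋_
  _≋_ : Rel (Edge G) 0ℓ
  _≋_ = 𝔡* G v

  ≋-isEquivalence : IsEquivalence _≋_
  ≋-isEquivalence = EqC.isEquivalence _

  open IsEquivalence ≋-isEquivalence using () renaming (sym to ≋-sym; trans to ≋-trans)

  ≈ᴱ⇒≋ : ∀ {e f} → _≈ᴱ_ G e f → e ≋ f
  ≈ᴱ⇒≋ p = EqC.return (inj₁ p)

  𝔡⇒≋ : ∀ {e f} → Incident G v e → δ G e f → e ≋ f
  𝔡⇒≋ i d = EqC.return (inj₂ (inj₁ i , d))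

  class-related : ∀ {i e f} → φ i e → φ i f → e ≋ f
  class-related {i} {e} {f} p q =
    let open Equivalence in ≋-trans (≋-sym (to (proj₂ (isClass i) e) p)) (to (proj₂ (isClass i) f) q)

  class-closed : ∀ {i e f} → φ i e → e ≋ f → φ i f
  class-closed {i} {e} {f} p q =
    let open Equivalence in from (proj₂ (isClass i) f) (≋-trans (to (proj₂ (isClass i) e) p) q)

  class-unique : ∀ {i j e} → φ i e → φ j e → i ≡ j
  class-unique {i} {j} p q = distinct i j
    ((λ r → class-closed q (class-related p r)) , (λ r → class-closed p (class-related q r)))

  N[_] : Fin k → Pred V 0ℓ
  N[ i ] = N G v (φ i)

  N⇒~ : ∀ {i a} → N[ i ] a → v ~ a
  N⇒~ (e , _ , j) = joins-~ e j

  N⇒≢ : ∀ {i a} → N[ i ] a → a ≢ v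
  N⇒≢ n p = ~⇒≢ (N⇒~ n) (sym p)

  N⇒φ : ∀ {i a} → N[ i ] a → ∀ e → Joins G e v a → φ i e
  N⇒φ (e , p , inj₁ (refl , refl)) f j = class-closed p (≋-sym (≈ᴱ⇒≋ j))
  N⇒φ (e , p , inj₂ (refl , refl)) f j = class-closed p (≋-sym (≈ᴱ⇒≋ (swap j)))

  ~⇒N : ∀ {a} → v ~ a → ∃[ i ] N[ i ] a
  ~⇒N a = let (i , p) = complete (edge v _ a) (inj₁ refl) in i , edge v _ a , p , inj₁ (refl , refl)

  N-unique : ∀ {i j a} → N[ i ] a → N[ j ] a → i ≡ j
  N-unique {a = a} p q = class-unique (N⇒φ p e (inj₁ (refl , refl))) (N⇒φ q e (inj₁ (refl , refl)))
    where
    e : Edge G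
    e = edge v a (N⇒~ p)

  -- The edge from `b` to `x` is opposite to the spoke at `a`, and the pair belongs to `𝔡` because
  -- that spoke is incident with `v`.
  opposite∈φ : ∀ {i a x b} → N[ i ] a → ChordlessSquare G v a x b → ∀ g → Joins G g b x → φ i g
  opposite∈φ {a = a} {x} {b} n sq g j =
    class-closed (N⇒φ n e (inj₁ (refl , refl)))
      (𝔡⇒≋ (inj₁ refl) (opposite v a x b sq (inj₁ (refl , refl)) (swap j)))
    where
    e : Edge G
    e = edge v a (N⇒~ n)

  -- Otherwise the `adjacent` clause would relate the two spokes and their classes would coincide.
  distinct⇒square : ∀ {i j a b} → i ≢ j → N[ i ] a → N[ j ] b → SpanUniqueChordless G v a b
  distinct⇒square {i} {j} {a} {b} i≢j p q with spanUnique? v a b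
  ... | yes s = s
  ... | no  n = ⊥-elim (i≢j (class-unique (class-closed (N⇒φ p e (inj₁ (refl , refl))) e≋f)
                                          (N⇒φ q f (inj₁ (refl , refl)))))
    where
    e f : Edge G
    e = edge v a (N⇒~ p)
    f = edge v b (N⇒~ q)
    e≋f : e ≋ f
    e≋f = 𝔡⇒≋ (inj₁ refl) (adjacent v a b (inj₁ (refl , refl)) (inj₁ (refl , refl))
                (λ { refl → i≢j (N-unique p q) }) n)

  -- A third common neighbour c would give av and ax two squares, with tops b
  -- and c, hence relate av to ax, which is opposite to vb.
  common-neighbours : ∀ {i j a b x c} → i ≢ j → N[ i ] a → N[ j ] b → ChordlessSquare G v a x b →
                      v ~ c → c ~ x → c ≡ a ⊎ c ≡ b
  common-neighbours {i} {j} {a} {b} {x} {c} i≢j p q S@(sq , _ , v≁x) v~c c~x with c ≟ a | c ≟ b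
  ... | yes c≡a | _       = inj₁ c≡a
  ... | no  _   | yes c≡b = inj₂ c≡b
  ... | no  c≢a | no  c≢b = ⊥-elim (i≢j (class-unique
    (class-closed (N⇒φ p e (inj₁ (refl , refl))) (𝔡⇒≋ (inj₁ refl)
      (adjacent a v x (inj₂ (refl , refl)) (inj₁ (refl , refl)) (x≉v ∘ sym) twoSquares)))
    (opposite∈φ q (chordless-flip S) g (inj₁ (refl , refl)))))
    where
    open Square sq
    e g : Edge G
    e = edge v a v~u
    g = edge a x u~x
    squareVia : ∀ d → v ~ d → d ~ x → d ≢ a → Square G a v d x
    squareVia d v~d d~x d≢a = record
      { v~u = ~-sym v~u ; u~x = v~d ; x~w = d~x ; w~v = ~-sym u~x
      ; u≉w = x≉v ∘ sym ; x≉v = d≢a ; x≉u = ~⇒≢ v~d ∘ sym ; x≉w = ~⇒≢ d~x }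
    twoSquares : ¬ SpanUniqueChordless G a v x
    twoSquares (_ , _ , unique) = c≢b (trans (unique c (squareVia c v~c c~x c≢a))
      (sym (unique b (squareVia b (~-sym w~v) (~-sym x~w) (u≉w ∘ sym)))))

  -- The star product

  factors : Fin k → Graph
  factors i = StarFactor G v (φ i)

  H : Graph
  H = StarProduct G v φ

  star : ∀ i → IsStar (StarFactor G v (φ i))
  star i = record
    { hub   = v , inj₁ refl
    ; _≈?_  = λ x y → proj₁ x ≟ proj₁ y
    ; spoke = λ { {_ , inj₁ p} n → ⊥-elim (n p) ; {_ , inj₂ p} _ → inj₁ (refl , p) }
    ; hub∈  = [ inj₁ ∘ proj₁ , inj₂ ∘ proj₁ ]′
    }

  open StarProducts factors star public hiding (_≈?_)

  infix 5 _at_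
  _at_ : Graph.Vertex H → Fin k → V
  h at i = proj₁ (h i)

  at-N : ∀ h {i} → h at i ≢ v → N[ i ] (h at i)
  at-N h {i} n = [ (λ p → ⊥-elim (n p)) , (λ p → p) ]′ (proj₂ (h i))

  -- The graph of γ, as a relation between vertices of G and of H.
  data Rep (x : V) (h : Graph.Vertex H) : Set where
    rep₀ : x ≡ v → (∀ l → h at l ≡ v) → Rep x h
    rep₁ : ∀ i → N[ i ] x → h at i ≡ x → (∀ l → l ≢ i → h at l ≡ v) → Rep x h
    rep₂ : ∀ i j {a b} → i ≢ j → N[ i ] a → N[ j ] b → ChordlessSquare G v a x b →
           h at i ≡ a → h at j ≡ b → (∀ l → l ≢ i → l ≢ j → h at l ≡ v) → Rep x h

  rep-v : ∀ {h} → Rep v h → ∀ l → h at l ≡ v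
  rep-v (rep₀ _ q)                   = q
  rep-v (rep₁ _ n _ _)               = ⊥-elim (N⇒≢ n refl)
  rep-v (rep₂ _ _ _ _ _ (s , _) _ _ _) = ⊥-elim (Square.x≉v s refl)

  rep-neighbour : ∀ {i a h} → N[ i ] a → Rep a h → h at i ≡ a × (∀ l → l ≢ i → h at l ≡ v)
  rep-neighbour n (rep₀ p _) = ⊥-elim (N⇒≢ n p)
  rep-neighbour n (rep₁ j m p q) with N-unique n m
  ... | refl = p , q
  rep-neighbour n (rep₂ _ _ _ _ _ (_ , _ , v≁x) _ _ _) = ⊥-elim (v≁x (N⇒~ n))

  -- The two neighbours of `v` recorded in a `rep₂` are common neighbours of `v` and `x`. By
  -- `common-neighbours` they are `a` and `b` in one of the two orders, and their classes follow.
  rep-top : ∀ {i j a b x h} → i ≢ j → N[ i ] a → N[ j ] b → ChordlessSquare G v a x b → Rep x h →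
            h at i ≡ a × h at j ≡ b × (∀ l → l ≢ i → l ≢ j → h at l ≡ v)
  rep-top _ _ _ (sq , _) (rep₀ p _) = ⊥-elim (Square.x≉v sq p)
  rep-top _ _ _ (_ , _ , v≁x) (rep₁ _ n _ _) = ⊥-elim (v≁x (N⇒~ n))
  rep-top i≢j p q S (rep₂ i′ j′ i′≢j′ p′ q′ (sq′ , _) r s t)
    with common-neighbours i≢j p q S v~u u~x | common-neighbours i≢j p q S (~-sym w~v) (~-sym x~w)
    where open Square sq′
  ... | inj₁ refl | inj₁ refl = ⊥-elim (i′≢j′ (N-unique p′ q′))
  ... | inj₂ refl | inj₂ refl = ⊥-elim (i′≢j′ (N-unique p′ q′))
  ... | inj₁ refl | inj₂ refl with N-unique p p′ | N-unique q q′
  ...   | refl | refl = r , s , t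
  rep-top i≢j p q S (rep₂ i′ j′ i′≢j′ p′ q′ (sq′ , _) r s t) | inj₂ refl | inj₁ refl
    with N-unique p q′ | N-unique q p′
  ...   | refl | refl = s , r , λ l m n → t l n m

  -- This makes `γ` well defined: `repOf` chooses the representative from the proof that a vertex
  -- belongs to the partial star product, and different proofs may give different choices.
  rep-functional : ∀ {x h h′} → Rep x h → Rep x h′ → ∀ l → h at l ≡ h′ at l
  rep-functional (rep₀ refl p) r l = trans (p l) (sym (rep-v r l))
  rep-functional (rep₁ i n p q) r l with l ≟ i
  ... | yes refl = trans p (sym (proj₁ (rep-neighbour n r)))
  ... | no  m    = trans (q l m) (sym (proj₂ (rep-neighbour n r) l m))
  rep-functional (rep₂ i j i≢j p q S a b off) r l with l ≟ i | l ≟ j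
  ... | yes refl | _        = trans a (sym (proj₁ (rep-top i≢j p q S r)))
  ... | no  _    | yes refl = trans b (sym (proj₁ (proj₂ (rep-top i≢j p q S r))))
  ... | no  m    | no  n    = trans (off l m n) (sym (proj₂ (proj₂ (rep-top i≢j p q S r)) l m n))

  rep-resp : ∀ {x h h′} → (∀ l → h at l ≡ h′ at l) → Rep x h → Rep x h′
  rep-resp e (rep₀ p q)     = rep₀ p (λ l → trans (sym (e l)) (q l))
  rep-resp e (rep₁ i n p q) = rep₁ i n (trans (sym (e i)) p) (λ l m → trans (sym (e l)) (q l m))
  rep-resp e (rep₂ i j i≢j p q S a b off) =
    rep₂ i j i≢j p q S (trans (sym (e i)) a) (trans (sym (e j)) b) (λ l m n → trans (sym (e l)) (off l m n))

  rep-none : ∀ {x h} → (∀ l → h at l ≡ v) → Rep x h → x ≡ v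
  rep-none e (rep₀ p _)                   = p
  rep-none e (rep₁ i n p _)               = ⊥-elim (N⇒≢ n (trans (sym p) (e i)))
  rep-none e (rep₂ i _ _ p _ _ a _ _) = ⊥-elim (N⇒≢ p (trans (sym a) (e i)))

  rep-one : ∀ {x h i} → h at i ≢ v → (∀ l → l ≢ i → h at l ≡ v) → Rep x h → x ≡ h at i
  rep-one {i = i} leaf off (rep₀ _ q) = ⊥-elim (leaf (q i))
  rep-one {i = i} leaf off (rep₁ j n p q) with j ≟ i
  ... | yes refl = sym p
  ... | no  j≢i  = ⊥-elim (leaf (q i (j≢i ∘ sym)))
  rep-one {i = i} leaf off (rep₂ j l j≢l p q S a b _) with j ≟ i
  ... | yes refl = ⊥-elim (N⇒≢ q (trans (sym b) (off l (j≢l ∘ sym))))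
  ... | no  j≢i  = ⊥-elim (N⇒≢ p (trans (sym a) (off j j≢i)))

  rep-two : ∀ {x h i j} → i ≢ j → h at i ≢ v → h at j ≢ v → Rep x h →
            ChordlessSquare G v (h at i) x (h at j) × (∀ l → l ≢ i → l ≢ j → h at l ≡ v)
  rep-two {i = i} i≢j lᵢ lⱼ (rep₀ _ q) = ⊥-elim (lᵢ (q i))
  rep-two {i = i} {j} i≢j lᵢ lⱼ (rep₁ m _ _ q) with i ≟ m
  ... | yes refl = ⊥-elim (lⱼ (q j (i≢j ∘ sym)))
  ... | no  i≢m  = ⊥-elim (lᵢ (q i i≢m))
  rep-two {i = i} {j} i≢j lᵢ lⱼ (rep₂ m n m≢n p q S refl refl off) with i ≟ m | i ≟ n | j ≟ m | j ≟ n
  ... | yes refl | _        | yes refl | _        = ⊥-elim (i≢j refl)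
  ... | yes refl | _        | no  _    | yes refl = S , off
  ... | no  _    | yes refl | yes refl | _        = chordless-flip S , λ l r s → off l s r
  ... | no  _    | yes refl | no  _    | yes refl = ⊥-elim (i≢j refl)
  ... | no  i≢m  | no  i≢n  | _        | _        = ⊥-elim (lᵢ (off i i≢m i≢n))
  ... | _        | _        | no  j≢m  | no  j≢n  = ⊥-elim (lⱼ (off j j≢m j≢n))

  -- In the `rep₂` case both vertices are tops of squares on the same two spokes, and these spokes
  -- span only one square.
  rep-injective : ∀ {x y h} → Rep x h → Rep y h → x ≡ y
  rep-injective (rep₀ refl q) r = sym (rep-none q r)
  rep-injective (rep₁ i n refl q) r = sym (rep-one (N⇒≢ n) q r)
  rep-injective {x} {y} (rep₂ i j i≢j p q S refl refl _) r =
    let (_ , _ , unique) = distinct⇒square i≢j p q in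
    trans (unique x (proj₁ S)) (sym (unique y (proj₁ (proj₁ (rep-two i≢j (N⇒≢ p) (N⇒≢ q) r)))))

  sparse⇒rep : ∀ {h} → Sparse h → ∃[ x ] Rep x h
  sparse⇒rep (none p) = v , rep₀ refl p
  sparse⇒rep {h} (one i leaf off) = h at i , rep₁ i (at-N h leaf) refl off
  sparse⇒rep {h} (two i j i≢j lᵢ lⱼ off) =
    let (x , S , _) = distinct⇒square i≢j (at-N h lᵢ) (at-N h lⱼ) in
    x , rep₂ i j i≢j (at-N h lᵢ) (at-N h lⱼ) S refl refl off

  rep⇒sparse : ∀ {x h} → Rep x h → Sparse h
  rep⇒sparse (rep₀ _ q) = none q
  rep⇒sparse (rep₁ i n refl q) = one i (N⇒≢ n) q
  rep⇒sparse (rep₂ i j i≢j p q S refl refl off) = two i j i≢j (N⇒≢ p) (N⇒≢ q) off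

  -- Vertices and edges of S

  private
    Sᵥ = S G v

  repOf-v : ∃[ h ] Rep v h
  repOf-v = hubs , rep₀ refl (λ _ → refl)

  repOf-neighbour : ∀ {a} → v ~ a → ∃[ h ] Rep a h
  repOf-neighbour {a} v~a = let (i , n) = ~⇒N v~a in
    hubs [ i ≔ (a , inj₂ n) ] , rep₁ i n (cong proj₁ (≔-same hubs i)) λ l m → cong proj₁ (≔-other hubs m)

  repOf-top : ∀ {i j a b x} → i ≢ j → N[ i ] a → N[ j ] b → ChordlessSquare G v a x b → ∃[ h ] Rep x h
  repOf-top {i} {j} {a} {b} i≢j p q S =
    h [ j ≔ (b , inj₂ q) ] , rep₂ i j i≢j p q S
      (cong proj₁ (trans (≔-other h i≢j) (≔-same hubs i))) (cong proj₁ (≔-same h j))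
      λ l m n → cong proj₁ (trans (≔-other h n) (≔-other hubs m))
    where
    h : Graph.Vertex H
    h = hubs [ i ≔ (a , inj₂ p) ]

  -- In `topEdge` the square is oriented so that `i` is the class of the spoke opposite to `g`,
  -- which is the coordinate that `g` moves in `H`.
  data ProductEdge (g : Edge G) : Set where
    spokeEdge : ∀ {i a} → N[ i ] a → Joins G g v a → ProductEdge g
    topEdge   : ∀ {i j a b x} → i ≢ j → N[ i ] a → N[ j ] b → ChordlessSquare G v a x b →
                Joins G g b x → ProductEdge g

  productEdge : ∀ g → StarProductEdge G v g → ProductEdge g
  productEdge g (inj₁ inc) =
    let (a , j) = incident-joins g inc in spokeEdge (proj₂ (~⇒N (joins-~ g j))) j
  productEdge g (inj₂ (e , e′ , u , x , w , vu , vw , e≉e′ , S , j)) =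
    -- The edge from `u` to `x` is opposite to the spoke at `w`, so the square is flipped in the
    -- first alternative.
    [ topEdge (colours≢ ∘ sym) (proj₂ (~⇒N (joins-~ e′ vw))) (proj₂ (~⇒N (joins-~ e vu))) (chordless-flip S)
    , topEdge colours≢ (proj₂ (~⇒N (joins-~ e vu))) (proj₂ (~⇒N (joins-~ e′ vw))) S ]′ j
    where
    colours≢ : proj₁ (~⇒N (joins-~ e vu)) ≢ proj₁ (~⇒N (joins-~ e′ vw))
    colours≢ p = e≉e′ (class-related (N⇒φ (proj₂ (~⇒N (joins-~ e vu))) e vu)
      (subst (λ i → φ i e′) (sym p) (N⇒φ (proj₂ (~⇒N (joins-~ e′ vw))) e′ vw)))

  topEdge∈F : ∀ {i j a b x} → i ≢ j → N[ i ] a → N[ j ] b → ChordlessSquare G v a x b →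
              ∀ g → Joins G g b x → StarProductEdge G v g
  topEdge∈F {a = a} {b} {x} i≢j p@(e , e∈φ , vu) q@(f , f∈φ , vw) S g j =
    inj₂ (e , f , a , x , b , vu , vw , (λ r → i≢j (class-unique (class-closed e∈φ r) f∈φ)) , S , inj₂ j)

  repOf : ∀ {x} → StarProductVertex G v x → ∃[ h ] Rep x h
  repOf (inj₁ refl) = repOf-v
  repOf (inj₂ (g , g∈S , inc)) with productEdge g g∈S | incident-joins g inc
  ... | spokeEdge n j | _ , j′ with joins-ends g j′ j
  ...   | inj₁ (refl , _) = repOf-v
  ...   | inj₂ (refl , _) = repOf-neighbour (N⇒~ n)
  repOf (inj₂ (g , g∈S , inc)) | topEdge i≢j p q S j | _ , j′ with joins-ends g j′ j
  ...   | inj₁ (refl , _) = repOf-neighbour (N⇒~ q)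
  ...   | inj₂ (refl , _) = repOf-top i≢j p q S

  rep⇒vertex : ∀ {x h} → Rep x h → StarProductVertex G v x
  rep⇒vertex (rep₀ p _) = inj₁ p
  rep⇒vertex (rep₁ i (e , _ , j) _ _) = inj₂ (e , inj₁ (joins-incident e j) , joins-incident e (swap j))
  rep⇒vertex {x} (rep₂ i j {a} {b} i≢j p q S _ _ _) =
    inj₂ (g , topEdge∈F i≢j p q S g (inj₁ (refl , refl)) , inj₂ refl)
    where
    g : Edge G
    g = edge b x (~-sym (Square.x~w (proj₁ S)))

  Steps : Fin k → Rel (Graph.Vertex H) 0ℓ
  Steps = StepsAt factors

  steps-sym : ∀ {i} h h′ → Steps i h h′ → Steps i h′ h
  steps-sym h h′ = stepsAt-sym factors {x = h} {y = h′}

  steps-spoke : ∀ {i a h h′} → N[ i ] a → Rep v h → Rep a h′ → Steps i h h′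
  steps-spoke {i} n r r′ =
    inj₁ (rep-v r i , subst N[ i ] (sym (proj₁ (rep-neighbour n r′))) n) ,
    λ l m → trans (rep-v r l) (sym (proj₂ (rep-neighbour n r′) l m))

  steps-top : ∀ {i j a b x h h′} → i ≢ j → N[ i ] a → N[ j ] b → ChordlessSquare G v a x b →
              Rep b h → Rep x h′ → Steps i h h′
  steps-top {i} {j} {h = h} {h′} i≢j p q S r r′ =
    inj₁ (proj₂ (rep-neighbour q r) i i≢j , subst N[ i ] (sym (proj₁ (rep-top i≢j p q S r′))) p) , off
    where
    off : ∀ l → l ≢ i → h at l ≡ h′ at l
    off l l≢i with l ≟ j
    ... | yes refl = trans (proj₁ (rep-neighbour q r)) (sym (proj₁ (proj₂ (rep-top i≢j p q S r′))))
    ... | no  l≢j  = trans (proj₂ (rep-neighbour q r) l l≢j)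
                       (sym (proj₂ (proj₂ (rep-top i≢j p q S r′)) l l≢i l≢j))

  edge⇒steps : ∀ g {x y h h′} → StarProductEdge G v g → Joins G g x y → Rep x h → Rep y h′ →
               ∃[ i ] φ i g × Steps i h h′
  edge⇒steps g {h = h} {h′} g∈S xy r r′ with productEdge g g∈S
  ... | spokeEdge n j with joins-ends g xy j
  ...   | inj₁ (refl , refl) = _ , N⇒φ n g j , steps-spoke n r r′
  ...   | inj₂ (refl , refl) = _ , N⇒φ n g j , steps-sym h′ h (steps-spoke n r′ r)
  edge⇒steps g {h = h} {h′} g∈S xy r r′ | topEdge i≢j p q S j with joins-ends g xy j
  ...   | inj₁ (refl , refl) = _ , opposite∈φ p S g j , steps-top i≢j p q S r r′
  ...   | inj₂ (refl , refl) = _ , opposite∈φ p S g j , steps-sym h′ h (steps-top i≢j p q S r′ r)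

  SEdge : Rel V 0ℓ
  SEdge x y = ∃[ e ] StarProductEdge G v e × Joins G e x y

  -- The cases follow the position of `x`. From `v` the step is a spoke. From a neighbour of `v` it
  -- leads to the top of the square on the two leaves of `h′`, along an edge of `F`. From a top it
  -- would create a third leaf coordinate, which `rep-two` excludes.
  steps⇒edge′ : ∀ {i x y h h′} → h at i ≡ v → N[ i ] (h′ at i) → (∀ l → l ≢ i → h at l ≡ h′ at l) →
                Rep x h → Rep y h′ → SEdge x y
  steps⇒edge′ {i} {h′ = h′} c n off (rep₀ refl q) r′
    with rep-one (N⇒≢ n) (λ l m → trans (sym (off l m)) (q l)) r′ | n
  ... | refl | e , _ , j = e , inj₁ (joins-incident e j) , j
  steps⇒edge′ {i} {x} {y} {h} {h′} c n off (rep₁ j m refl q) r′ =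
    g , topEdge∈F i≢j n (subst N[ j ] at-j m) S′ g (inj₁ (at-j , refl)) , inj₁ (refl , refl)
    where
    i≢j : i ≢ j
    i≢j refl = N⇒≢ m c
    at-j : h at j ≡ h′ at j
    at-j = off j (i≢j ∘ sym)
    S′ : ChordlessSquare G v (h′ at i) y (h′ at j)
    S′ = proj₁ (rep-two i≢j (N⇒≢ n) (λ e → N⇒≢ m (trans at-j e)) r′)
    g : Edge G
    g = edge x y (subst (_~ y) (sym at-j) (~-sym (Square.x~w (proj₁ S′))))
  steps⇒edge′ {i} {h = h} {h′} c n off (rep₂ j l j≢l p q S refl refl _) r′ =
    ⊥-elim (N⇒≢ q (trans (off l (i≢l ∘ sym)) (proj₂
      (rep-two i≢j (N⇒≢ n) (λ e → N⇒≢ p (trans (off j (i≢j ∘ sym)) e)) r′) l (i≢l ∘ sym) (j≢l ∘ sym))))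
    where
    i≢j : i ≢ j
    i≢j refl = N⇒≢ p c
    i≢l : i ≢ l
    i≢l refl = N⇒≢ q c

  steps⇒edge : ∀ {i x y h h′} → Steps i h h′ → Rep x h → Rep y h′ → SEdge x y
  steps⇒edge (inj₁ (c , n) , off) r r′ = steps⇒edge′ c n off r r′
  steps⇒edge (inj₂ (c , n) , off) r r′ =
    let (e , e∈S , j) = steps⇒edge′ c n (λ l m → sym (off l m)) r′ r in e , e∈S , swap j

  -- The isomorphism onto the ball and its isometry

  Ball : Graph
  Ball = ⟨_⟩ H (N₂[_] H (centre G v φ))

  γ : Sᵥ ≅ Ball
  γ = record
    { bijection = record
      { to        = λ (x , x∈S) → proj₁ (repOf x∈S) , sparse⇒N₂ (rep⇒sparse (proj₂ (repOf x∈S)))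
      ; from      = λ (h , h∈N₂) → proj₁ (pre h∈N₂) , rep⇒vertex (proj₂ (pre h∈N₂))
      ; to-cong   = λ { {_ , x∈S} {_ , y∈S} refl → rep-functional (proj₂ (repOf x∈S)) (proj₂ (repOf y∈S)) }
      ; from-cong = λ {(_ , p)} {(_ , q)} e → rep-injective (rep-resp e (proj₂ (pre p))) (proj₂ (pre q))
      ; inverse   =
          (λ { {h , p} {x , x∈S} refl → rep-functional (proj₂ (repOf x∈S)) (proj₂ (pre p)) }) ,
          (λ { {x , x∈S} {h , p} e → rep-injective (rep-resp e (proj₂ (pre p))) (proj₂ (repOf x∈S)) })
      }
    ; ~-preserving = λ {(_ , x∈S)} {(_ , y∈S)} (e , e∈S , j) →
        let (i , _ , st) = edge⇒steps e e∈S j (proj₂ (repOf x∈S)) (proj₂ (repOf y∈S)) in i , st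
    ; ~-reflecting = λ {(_ , x∈S)} {(_ , y∈S)} (i , st) →
        steps⇒edge st (proj₂ (repOf x∈S)) (proj₂ (repOf y∈S))
    }
    where
    pre : ∀ {h} → N₂[_] H (centre G v φ) h → ∃[ x ] Rep x h
    pre p = sparse⇒rep (N₂⇒sparse p)

  γᴴ : Graph.Vertex Sᵥ → Graph.Vertex H
  γᴴ x = proj₁ (_≅_.to γ x)

  γᴴ-rep : ∀ x → Rep (proj₁ x) (γᴴ x)
  γᴴ-rep (_ , x∈S) = proj₂ (repOf x∈S)

  walk-image : ∀ {n x y} → Walk Sᵥ n x y → Walk H n (γᴴ x) (γᴴ y)
  walk-image {x = x} {y} (stop p)           = stop (_≅_.to-cong γ {x} {y} p)
  walk-image {x = x} (step {y = y} a w) = step (_≅_.~-preserving γ {x} {y} a) (walk-image w)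

  ball-walk : ∀ {n h h′} → Walk Ball n h h′ → Walk Sᵥ n (_≅_.from γ h) (_≅_.from γ h′)
  ball-walk {h = h} {h′} (stop p)           = stop (_≅_.from-cong γ {h} {h′} p)
  ball-walk {h = h} (step {y = h′} a w) = step (from-preserving γ {h} {h′} a) (ball-walk w)

  -- A walk in `H` may leave the ball, so `ball-isometric` first replaces it by one inside that is
  -- no longer; the latter is pulled back through the inverse of `γ`.
  walk-preimage : ∀ {n x y} → Walk H n (γᴴ x) (γᴴ y) → ∃[ m ] m ≤ n × Walk Sᵥ m x y
  walk-preimage {x = x} {y} w =
    let (m , m≤n , w′) = ball-isometric (_≅_.to γ x) (_≅_.to γ y) w in
    m , m≤n , walk-respˡ Sᵥ (≅-from∘to γ x) (walk-reverse Sᵥ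
      (walk-respˡ Sᵥ (≅-from∘to γ y) (walk-reverse Sᵥ (ball-walk w′))))

  γ-isometric : IsIsometricEmbedding Sᵥ H γᴴ
  γ-isometric = record
    { cong      = λ {x} {y} → _≅_.to-cong γ {x} {y}
    ; injective = λ {x} {y} → ≅-injective γ {x} {y}
    ; distance  = λ x y n → mk⇔
        (λ (w , least) → walk-image w , λ m w′ →
          let (l , l≤m , w″) = walk-preimage w′ in ≤-trans (least l w″) l≤m)
        -- The walk pulled back has length `m ≤ n`, and its image in `H` cannot be shorter than `n`,
        -- so the lengths agree.
        (λ (w , least) → let (m , m≤n , w′) = walk-preimage w in
          subst (λ m → Walk Sᵥ m x y) (≤-antisym m≤n (least m (walk-image w′))) w′ ,
          λ m w″ → least m (walk-image w″))
    }

  -- Classes of σ and 𝔡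

  dirᴴ : Edge H → Fin k
  dirᴴ = dir factors

  spokeVertex : ∀ i → ∃[ a ] N[ i ] a
  spokeVertex i = let (e , inc , e∈φ) = meets i ; (a , j) = incident-joins e inc in a , e , e∈φ , j

  spokeOfFactor : ∀ i → ∃[ x ] ∃[ y ] Graph._~_ (StarFactor G v (φ i)) x y
  spokeOfFactor i = let (a , n) = spokeVertex i in (v , inj₁ refl) , (a , inj₂ n) , inj₁ (refl , n)

  starFactorization : PrimeFactorization H
  starFactorization = record
    { size   = k
    ; factor = factors
    ; prime  = λ i → let (x , y , s) = spokeOfFactor i in IsStar.star-prime (star i) {x} {y} s
    ; iso    = ≅-refl
    }

  dir⇒σ : ∀ e f → dirᴴ e ≡ dirᴴ f → σ H e f
  dir⇒σ e f p = starFactorization , dirᴴ e , differs e refl , differs f p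
    where
    differs : ∀ {i} e → i ≡ dirᴴ e → PrimeFactorization.DifferAt starFactorization i e
    differs e refl = stepsAt-≉ factors {x = Edge.src e} {y = Edge.tgt e} (proj₂ (Edge.adjacent e))

  -- The witness `D` is arbitrary, so uniqueness of the prime factorization enters here: every `D`
  -- separates the star directions.
  σ⇒dir : ∀ e f → σ H e f → dirᴴ e ≡ dirᴴ f
  σ⇒dir e f (D , s , p , q) = same-factor⇒same-dir factors hubs
    □-stars-connected spokeOfFactor parallel D e f p q

  σ-classes : NumberOfClasses (σ H) k
  σ-classes = record
    { refl  = λ {e} → dir⇒σ e e refl
    ; sym   = λ (D , s , p , q) → D , s , q , p
    -- The two instances of `σ` may carry different factorizations; they are composed through
    -- directions.
    ; trans = λ {e} {f} {g} p q → dir⇒σ e g (trans (σ⇒dir e f p) (σ⇒dir f g q))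
    } , record
    { to = spokeᴴ ; from = dirᴴ
    ; to-cong = λ { {i} refl → dir⇒σ (spokeᴴ i) (spokeᴴ i) refl } ; from-cong = λ {e} {f} → σ⇒dir e f
    ; inverse = (λ { {e} {i} refl → dir⇒σ (spokeᴴ i) e refl }) , (λ {i} {e} p → σ⇒dir e (spokeᴴ i) p)
    }
    where
    spokeᴴ : Fin k → Edge H
    spokeᴴ i = let (x , y , s) = spokeOfFactor i in edgeAt factors i hubs {x} {y} s

  image : Edge Sᵥ → Edge H
  image = mapEdge {Y = H} γ

  -- This links classes of `𝔡*` to coordinates of `H`. The direction of the image reduces to the
  -- index found by `edge⇒steps`, whose membership proof concerns the witness edge `e`; `≈ᴱ⇒≋`
  -- passes to the copy of it rebuilt by `inclusion`.
  dir-image∈φ : ∀ e → φ (dirᴴ (image e)) (inclusion G v e)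
  dir-image∈φ (edge (x , x∈S) (y , y∈S) (e , e∈S , j)) =
    class-closed (proj₁ (proj₂ (edge⇒steps e e∈S j (proj₂ (repOf x∈S)) (proj₂ (repOf y∈S))))) (≈ᴱ⇒≋ j)

  𝔡⇒dir : ∀ e f → 𝔡∣S G v e f → dirᴴ (image e) ≡ dirᴴ (image f)
  𝔡⇒dir e f p = class-unique (class-closed (dir-image∈φ e) p) (dir-image∈φ f)

  dir⇒𝔡 : ∀ e f → dirᴴ (image e) ≡ dirᴴ (image f) → 𝔡∣S G v e f
  dir⇒𝔡 e f p = class-related (subst (λ i → φ i (inclusion G v e)) p (dir-image∈φ e)) (dir-image∈φ f)

  𝔡-classes : NumberOfClasses (𝔡∣S G v) k
  𝔡-classes = On.isEquivalence (inclusion G v) ≋-isEquivalence , record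
    { to = spokeˢ ; from = dirᴴ ∘ image
    ; to-cong = λ { {i} refl → dir⇒𝔡 (spokeˢ i) (spokeˢ i) refl } ; from-cong = λ {e} {f} → 𝔡⇒dir e f
    ; inverse = (λ { {e} {i} refl → dir⇒𝔡 (spokeˢ i) e (dir-spokeˢ i) }) ,
                (λ {i} {e} p → trans (𝔡⇒dir e (spokeˢ i) p) (dir-spokeˢ i))
    }
    where
    spokeˢ : Fin k → Edge Sᵥ
    spokeˢ i = let (a , n@(e , _ , j)) = spokeVertex i in
      edge (centreˢ G v) (neighbourˢ G v n) (e , inj₁ (joins-incident e j) , j)
    dir-spokeˢ : ∀ i → dirᴴ (image (spokeˢ i)) ≡ i
    dir-spokeˢ i = let (_ , (e , e∈φ , j)) = spokeVertex i in
      class-unique (dir-image∈φ (spokeˢ i)) (class-closed e∈φ (≈ᴱ⇒≋ j))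

theorem3p7 : (Γ : FinGraph) → let G = FinGraph.graph Γ in
  (v : Graph.Vertex G) (k : ℕ) (φ : Fin k → Pred (Edge G) 0ℓ) → Enumerates G v φ →
  let open Graph G using (_≈_)
      Sᵥ = S G v
      H  = StarProduct G v φ
      v̄  = centre G v φ
  in
  Σ[ γ ∈ Sᵥ ≅ ⟨_⟩ H (N₂[_] H v̄) ]
    (let γᴴ : Graph.Vertex Sᵥ → Graph.Vertex H
         γᴴ x = proj₁ (_≅_.to γ x)
     in
     (Graph._≈_ H (γᴴ (centreˢ G v)) v̄
      × (∀ i u (n : N G v (φ i) u) →
           proj₁ (γᴴ (neighbourˢ G v n) i) ≈ u
           × (∀ j → j ≢ i → proj₁ (γᴴ (neighbourˢ G v n) j) ≈ v))
      × IsIsometricEmbedding Sᵥ H γᴴ)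
     × ((∀ e f → 𝔡∣S G v e f → TransClosure (δ H) (mapEdge γ e) (mapEdge γ f))
        × (∀ e f → TransClosure (δ H) e f → σ H e f))
     × (∃[ n ] NumberOfClasses (σ H) n × NumberOfClasses (𝔡∣S G v) n))
theorem3p7 Γ v k φ enumerates =
  γ ,
  ((λ _ → refl) , (λ i u n → rep-neighbour n (γᴴ-rep (neighbourˢ (FinGraph.graph Γ) v n))) , γ-isometric) ,
  ((λ e f p → parallel (image e) (image f) (𝔡⇒dir e f p)) , λ e f p → dir⇒σ e f (δ⁺⇒dir factors p)) ,
  (k , σ-classes , 𝔡-classes)
  where open StarProductAt Γ v k φ enumerates
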